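{- Let $\mathcal{C}$ be a class of graphs closed under taking subgraphs. Then the following three statements are equivalent: 1. First-order logic (FO) and monadic second-order logic (MSO) have the same expressive power on $\mathcal{C}$. 2. First-order logic (FO) and guarded second-order logic (GSO) have the same expressive power on $\mathcal{C}$. 3. $\mathcal{C}$ has bounded tree depth.
   Context: Graphs are undirected and simple, viewed as logical structures over the vocabulary $\{E\}$ with $E$ binary (the symmetric, irreflexive edge relation), whose universe is the vertex set. A subgraph is obtained by arbitrarily deleting vertices and edges. **Tree depth.** Let $G=(V,E)$ be a graph with connected components $(G_i)_{i\in I}$; $G[U]$ denotes the subgraph induced on $U\subseteq V$. The tree depth $\mathrm{td}(G)$ is defined recursively by $$\mathrm{td}(G)=\begin{cases}1 & \text{if } |V|=1,\\ 1+\min_{x\in V}\mathrm{td}(G[V\setminus\{x\}]) & \text{if } |V|>1 \text{ and } |I|=1,\\ \max_{i\in I}\mathrm{td}(G_i) & \text{otherwise.}\end{cases}$$ A class $\mathcal{C}$ of graphs has bounded tree depth if there is $d\in\mathbb{N}$ such that $\mathrm{td}(G)\le d$ for every $G\in\mathcal{C}$. **Logics.** FO is first-order logic with equality. MSO is the fragment of second-order logic in which all second-order variables are monadic (arity 1, i.e. range over sets of vertices). GSO has the same syntax as full second-order logic (relation variables of arbitrary arity), but its semantics allows only guarded relations as values of second-order variables: the Gaifman graph of a relation $R\subseteq S^r$ on a set $S$ is the undirected graph with vertex set $S$ in which two distinct $u,v$ are adjacent iff both occur in a common tuple of $R$; the Gaifman graph of a structure is the union of the Gaifman graphs of its relations;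 and $R$ is guarded in a structure with universe $S$ if the Gaifman graph of $R$ is a subgraph of the Gaifman graph of the structure. **Expressive power.** For logics $L_1,L_2$ and a class $\mathcal{C}$ of structures, $L_1\leqq_{\mathcal{C}}L_2$ means that for every $L_1$-sentence $\varphi_1$ there is an $L_2$-sentence $\varphi_2$ such that exactly the same members of $\mathcal{C}$ satisfy $\varphi_1$ and $\varphi_2$. $L_1$ and $L_2$ have the same expressive power on $\mathcal{C}$ if $L_1\leqq_{\mathcal{C}}L_2$ and $L_2\leqq_{\mathcal{C}}L_1$. -}

module Defs where

open import Level using (Lift; _⊔_; 0ℓ) renaming (suc to lsuc)
open import Data.Empty using (⊥)
open import Data.Fin using (Fin)
open import Data.List as List using (List)
import Data.List.Membership.Propositional as ListMembership
open import Data.List.Relation.Unary.All as All using (All)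
open import Data.Nat using (ℕ; suc)
open import Data.Product using (Σ-syntax; ∃-syntax; _×_)
open import Data.Refinement using (Refinement; value)
open import Data.Sum using (_⊎_)
open import Data.Unit using (⊤)
open import Data.Vec as Vec using (Vec; []; _∷_)
open import Data.Vec.Membership.Propositional using (_∈_)
open import Function using (_⇔_)
open import Function.Definitions using (Injective)
open import Relation.Binary using (Rel; Symmetric; Irreflexive)
open import Relation.Binary.Construct.Closure.ReflexiveTransitive using (Star)
open import Relation.Binary.PropositionalEquality using (_≡_; _≢_; refl)
open import Relation.Nullary using (¬_)
open import Relation.Unary using (Pred)

------------------------------------------------------------------------
-- Graphs (of arbitrary cardinality)

record Graph : Set₁ where
  field
    V      : Set
    E      : Rel V 0ℓ
    sym    : Symmetric E
    irrefl : Irreflexive _≡_ E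

open Graph using (V; E)

-- The vertices of G [ U ] are those of G lying in U; the membership proof is
-- irrelevant, so each vertex occurs exactly once.
_[_] : (G : Graph) → Pred (V G) 0ℓ → Graph
G [ U ] = record
  { V      = Refinement (V G) U
  ; E      = λ u v → E G (value u) (value v)
  ; sym    = Graph.sym G
  ; irrefl = λ { refl → Graph.irrefl G refl }
  }

_-_ : (G : Graph) → V G → Graph
G - x = G [ (λ v → v ≢ x) ]

-- Subgraphs are taken up to isomorphism: H arises from an isomorphic copy of
-- G by deleting vertices and edges.
record _⊑_ (H G : Graph) : Set where
  field
    embed     : V H → V G
    injective : Injective _≡_ _≡_ embed
    edge      : ∀ {u v} → E H u v → E G (embed u) (embed v)

SubgraphClosed : ∀ {c} → Pred Graph c → Set (lsuc 0ℓ ⊔ c)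
SubgraphClosed C = ∀ {G H} → H ⊑ G → C G → C H

------------------------------------------------------------------------
-- Tree depth

OneVertex : Graph → Set
OneVertex G = Σ[ x ∈ V G ] ∀ y → y ≡ x

ManyVertices : Graph → Set
ManyVertices G = Σ[ x ∈ V G ] Σ[ y ∈ V G ] x ≢ y

Connected : Graph → Set
Connected G = ∀ u v → Star (E G) u v

component : (G : Graph) → V G → Graph
component G v = G [ Star (E G) v ]

-- td G ≤ d, with td G ∈ ℕ ∪ {∞} given by the recursion
--
--   td G = 1                         if G has one vertex,
--   td G = 1 + min_x td (G - x)      if G is connected with more vertices,
--   td G = max_i td (G_i)            otherwise, G_i the components of G.
--
-- A minimum is at most d iff some term is, a maximum (taken as 0 when there
-- is no component) iff all terms are.  On infinite graphs the recursion need
-- not terminate, but by induction on d it determines which graphs have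
-- td G ≤ d; graphs in no td_≤_ d have infinite tree depth.
data td_≤_ : Graph → ℕ → Set₁ where
  one   : ∀ {G d} → OneVertex G → td G ≤ suc d
  conn  : ∀ {G d} → ManyVertices G → Connected G →
          (x : V G) → td (G - x) ≤ d → td G ≤ suc d
  comps : ∀ {G d} → ¬ OneVertex G → ¬ (ManyVertices G × Connected G) →
          (∀ v → td (component G v) ≤ d) → td G ≤ d

BoundedTreeDepth : ∀ {c} → Pred Graph c → Set (lsuc 0ℓ ⊔ c)
BoundedTreeDepth C = ∃[ d ] (∀ G → C G → td G ≤ d)

------------------------------------------------------------------------
-- Syntax of second-order logic over {E}

-- Formulas whose quantified relation variables have arities in A, with n free
-- first-order variables and free relation variables of the arities listed
-- in Δ (de Bruijn indices in both cases).
data Formula (A : Pred ℕ 0ℓ) (n : ℕ) (Δ : List ℕ) : Set where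
  _≐_     : Fin n → Fin n → Formula A n Δ
  _~_     : Fin n → Fin n → Formula A n Δ
  _$_     : ∀ {r} → r ListMembership.∈ Δ → Vec (Fin n) r → Formula A n Δ
  not     : Formula A n Δ → Formula A n Δ
  _and_   : Formula A n Δ → Formula A n Δ → Formula A n Δ
  _or_    : Formula A n Δ → Formula A n Δ → Formula A n Δ
  ex all  : Formula A (suc n) Δ → Formula A n Δ
  ex₂ all₂ : ∀ r → A r → Formula A n (r List.∷ Δ) → Formula A n Δ

------------------------------------------------------------------------
-- Semantics

RelOn : Set → ℕ → Set₁
RelOn S r = Pred (Vec S r) 0ℓ

-- Adjacency in the Gaifman graph of R.
Gaifman : ∀ {S r} → RelOn S r → Rel S 0ℓ
Gaifman R u v = u ≢ v × ∃[ t ] (R t × u ∈ t × v ∈ t)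

edgeRel : (G : Graph) → RelOn (V G) 2
edgeRel G (u ∷ v ∷ []) = E G u v

-- E is the only relation of the structure G, so the Gaifman graph of G is
-- that of edgeRel G.
Guarded : (G : Graph) → ∀ {r} → RelOn (V G) r → Set
Guarded G R = ∀ {u v} → Gaifman R u v → Gaifman (edgeRel G) u v

Arbitrary : (G : Graph) → ∀ {r} → RelOn (V G) r → Set
Arbitrary G R = ⊤

-- Relation variables range over the relations satisfying Range G.
module Semantics (Range : (G : Graph) → ∀ {r} → RelOn (V G) r → Set)
                 {A : Pred ℕ 0ℓ} where

  Sat : (G : Graph) → ∀ {n Δ} → Vec (V G) n → All (RelOn (V G)) Δ →
        Formula A n Δ → Set₁
  Sat G ρ σ (i ≐ j)      = Lift (lsuc 0ℓ) (Vec.lookup ρ i ≡ Vec.lookup ρ j)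
  Sat G ρ σ (i ~ j)      = Lift (lsuc 0ℓ) (E G (Vec.lookup ρ i) (Vec.lookup ρ j))
  Sat G ρ σ (X $ is)     = Lift (lsuc 0ℓ) (All.lookup σ X (Vec.map (Vec.lookup ρ) is))
  Sat G ρ σ (not φ)      = ¬ Sat G ρ σ φ
  Sat G ρ σ (φ and ψ)    = Sat G ρ σ φ × Sat G ρ σ ψ
  Sat G ρ σ (φ or ψ)     = Sat G ρ σ φ ⊎ Sat G ρ σ ψ
  Sat G ρ σ (ex φ)       = Σ[ x ∈ V G ] Sat G (x ∷ ρ) σ φ
  Sat G ρ σ (all φ)      = (x : V G) → Sat G (x ∷ ρ) σ φ
  Sat G ρ σ (ex₂ r _ φ)  = Σ[ R ∈ RelOn (V G) r ] (Range G R × Sat G ρ (R All.∷ σ) φ)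
  Sat G ρ σ (all₂ r _ φ) = (R : RelOn (V G) r) → Range G R → Sat G ρ (R All.∷ σ) φ

------------------------------------------------------------------------
-- Logics and expressive power

record Logic : Set₂ where
  field
    Sentence : Set
    _⊨_      : Graph → Sentence → Set₁

logic : Pred ℕ 0ℓ → ((G : Graph) → ∀ {r} → RelOn (V G) r → Set) → Logic
logic A Range = record
  { Sentence = Formula A 0 List.[]
  ; _⊨_      = λ G φ → Semantics.Sat Range G [] All.[] φ
  }

FO MSO GSO : Logic
FO  = logic (λ r → ⊥)     Arbitrary
MSO = logic (λ r → r ≡ 1) Arbitrary
GSO = logic (λ r → ⊤)     Guarded

_≦⟨_⟩_ : ∀ {c} → Logic → Pred Graph c → Logic → Set (lsuc 0ℓ ⊔ c)
L₁ ≦⟨ C ⟩ L₂ =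
  ∀ (φ₁ : Logic.Sentence L₁) → Σ[ φ₂ ∈ Logic.Sentence L₂ ]
    (∀ G → C G → (Logic._⊨_ L₁ G φ₁ ⇔ Logic._⊨_ L₂ G φ₂))

SameExpressivePower : ∀ {c} → Pred Graph c → Logic → Logic → Set (lsuc 0ℓ ⊔ c)
SameExpressivePower C L₁ L₂ = L₁ ≦⟨ C ⟩ L₂ × L₂ ≦⟨ C ⟩ L₁

{-# OPTIONS --safe #-}

-- A subgraph-closed class without a bound on its paths contains all paths; MSO
-- can say that a path has even length, whereas FO cannot tell long paths apart.
-- If paths have boundedly many vertices, a depth-first search bounds the tree
-- depth.
--
-- Conversely, a graph of tree depth at most d has an elimination forest of
-- depth d.  Colour its nodes by their adjacency to their ancestors.  A guarded
-- tuple spans a clique, hence lies on a branch, so a guarded relation is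
-- nothing but a further colouring of the nodes with finitely many colours.  The
-- type of a coloured forest records which words of length at most t over the
-- types of its trees are spelled by distinct trees.  If t is large enough, every
-- recolouring of a forest can be copied to a forest of the same type; playing
-- this game, the type decides a given GSO sentence.  As components have bounded
-- diameter, the existence of an elimination forest of a given type is expressed
-- by an FO sentence, and there are finitely many types.

module Submission where

open import Defs
open import Axiom.ExcludedMiddle using (ExcludedMiddle)
open import Axiom.Extensionality.Propositional using (Extensionality)
open import Data.Bool using (Bool; true; false; T) renaming (not to notᵇ)
open import Data.Bool.Properties using (T-irrelevant; not-involutive)
open import Data.Empty using (⊥; ⊥-elim; ⊥-elim-irr)
open import Data.Fin as Fin using (Fin; zero; suc; toℕ; fromℕ<; fromℕ; inject₁)
import Data.Fin.Properties as Fin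
open import Data.List as List using
  ( List; []; _∷_; length; map; filter; cartesianProduct; cartesianProductWith; _++_ )
open import Data.List.Membership.Propositional using (_∈_; _∉_; find; lose)
open import Data.List.Membership.Propositional.Properties using
  ( ∈-∃++; ∈-++⁻; ∈-++⁺ˡ; ∈-++⁺ʳ; ∈-cartesianProduct⁺; ∈-cartesianProductWith⁺; ∈-filter⁺
  ; ∈-filter⁻; ∈-map⁺; ∈-map⁻; ∈-allFin; ∈-lookup )
open import Data.List.Properties using
  ( map-∘; ∷-injectiveˡ; ∷-injectiveʳ; length-map; length-filter; length-++; length-++-sucʳ
  ; map-id; tabulate-lookup; map-tabulate )
open import Data.List.Relation.Binary.Pointwise as Pointwise using (Pointwise; []; _∷_)
open import Data.List.Relation.Unary.All as All using (All; []; _∷_)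
import Data.List.Relation.Unary.All.Properties as All
open import Data.List.Relation.Unary.AllPairs using ([]; _∷_; AllPairs)
open import Data.List.Relation.Unary.Any using (here; there; Any)
open import Data.List.Relation.Unary.Linked as Linked using (Linked; []; [-]; _∷_)
import Data.List.Relation.Unary.Linked.Properties as Linked
open import Data.List.Relation.Unary.Unique.Propositional using (Unique)
import Data.List.Relation.Unary.Unique.Propositional.Properties as Unique
open import Data.Maybe using (Maybe; just; nothing)
open import Data.Maybe.Properties using (just-injective)
open import Data.Nat as ℕ using (ℕ; zero; suc; _+_; _*_; _≤_; _<_; z≤n; s≤s; _⊔_; _≤?_; _∸_; _^_)
import Data.Nat.Properties as ℕ
open import Data.Product using (Σ-syntax; ∃-syntax; _×_; _,_; proj₁; proj₂)
open import Data.Product.Properties using (,-injectiveˡ; ,-injectiveʳ)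
open import Data.Sum as Sum using (_⊎_; inj₁; inj₂; swap)
open import Data.Unit using (⊤; tt)
open import Data.Vec as Vec using (Vec; []; _∷_; lookup)
open import Data.Vec.Membership.Propositional using () renaming (_∈_ to _∈ᵛ_)
open import Data.Vec.Membership.Propositional.Properties using () renaming (∈-map⁺ to ∈ᵛ-map⁺)
import Data.Vec.Properties as Vec
open import Data.Vec.Relation.Unary.Any using (here; there)
open import Function using (_∘_; id; _⇔_; mk⇔; Equivalence)
open import Level using (0ℓ; Lift; lift; lower; Level) renaming (suc to lsuc)
open import Relation.Binary.Construct.Closure.ReflexiveTransitive using (Star; ε; _◅_; _◅◅_; gmap)
open import Relation.Binary.PropositionalEquality using
  ( _≡_; _≢_; refl; sym; trans; cong; cong₂; subst; subst₂ )
open import Relation.Nullary using (Dec; yes; no; ¬_; contradiction)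
open import Relation.Nullary.Decidable using (⌊_⌋; toWitness; fromWitness; map′)
open import Relation.Unary using (Pred)
open Graph using (V; E; irrefl) renaming (sym to E-sym)
open Equivalence

-- Only counting up to `t` keeps the set of types finite, and the game uses this precision up. A new
-- colouring splits a class of equal trees into subclasses that must again agree up to the threshold
-- of the remaining formula. If there are `q` possible refinements, a sample of `q * t` trees
-- represents every subclass up to `t`; with one index to spare, each tree outside the sample can be
-- given a refinement that already occurs `t` times in it. Hence thresholds exceed `q * t` and are
-- computed from the innermost quantifier outwards. A first-order sentence cannot name unboundedly
-- many trees. It names the roots of such a sample and demands that every other tree have a letter
-- occurring at least `t` times in it, which leaves the type unchanged. Elimination forests are not
-- unique, so the sentence asserts only that some forest has the given type. This suffices, because
-- the transfer of a GSO sentence depends on nothing but the equality of types.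

-- Families over arbitrary index sets, with multiplicities counted up to a threshold.

module Families (em : ∀ {P : Set} → Dec P) where

  private variable
    A B I J : Set

  record FinSet : Set₁ where
    field
      ∣_∣      : Set
      elems    : List ∣_∣
      complete : ∀ x → x ∈ elems
  open FinSet public

  _×ᶠ_ : FinSet → FinSet → FinSet
  X ×ᶠ Y = record
    { ∣_∣      = ∣ X ∣ × ∣ Y ∣
    ; elems    = cartesianProduct (elems X) (elems Y)
    ; complete = λ (x , y) → ∈-cartesianProduct⁺ (complete X x) (complete Y y)
    }

  Boolᶠ : FinSet
  Boolᶠ = record
    { ∣_∣      = Bool
    ; elems    = true ∷ false ∷ []
    ; complete = λ { true → here refl ; false → there (here refl) }
    }

  Vecᶠ : FinSet → ℕ → FinSet
  Vecᶠ X n = record { ∣_∣ = Vec ∣ X ∣ n ; elems = list n ; complete = compl }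
    where
    list : ∀ n → List (Vec ∣ X ∣ n)
    list zero    = [] ∷ []
    list (suc n) = cartesianProductWith _∷_ (elems X) (list n)

    compl : ∀ {n} (v : Vec ∣ X ∣ n) → v ∈ list n
    compl []      = here refl
    compl (x ∷ v) = ∈-cartesianProductWith⁺ _∷_ (complete X x) (compl v)

  wordsUpTo : (X : FinSet) → ℕ → List (List ∣ X ∣)
  wordsUpTo X zero    = [] ∷ []
  wordsUpTo X (suc t) = [] ∷ cartesianProductWith _∷_ (elems X) (wordsUpTo X t)

  ∈-wordsUpTo : ∀ X {t} w → length w ≤ t → w ∈ wordsUpTo X t
  ∈-wordsUpTo X {zero}  []      _       = here refl
  ∈-wordsUpTo X {suc t} []      _       = here refl
  ∈-wordsUpTo X {suc t} (x ∷ w) (s≤s l) =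
    there (∈-cartesianProductWith⁺ _∷_ (complete X x) (∈-wordsUpTo X w l))

  ⌊⌋-≡ : ∀ {P Q : Set} → ⌊ em {P} ⌋ ≡ ⌊ em {Q} ⌋ → P → Q
  ⌊⌋-≡ {P} {Q} eq p with em {P} | em {Q}
  ⌊⌋-≡ eq p | yes _ | yes q = q
  ⌊⌋-≡ eq p | no ¬p | _     = ⊥-elim (¬p p)

  ⌊⌋-cong : ∀ {P Q : Set} → (P → Q) → (Q → P) → ⌊ em {P} ⌋ ≡ ⌊ em {Q} ⌋
  ⌊⌋-cong {P} {Q} f g with em {P} | em {Q}
  ... | yes _ | yes _ = refl
  ... | yes p | no ¬q = contradiction (f p) ¬q
  ... | no ¬p | yes q = contradiction (g q) ¬p
  ... | no _  | no _  = refl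

  -- Deciding each instance by `em` turns an arbitrary property into a point of a finite set; this
  -- is how types and guarded relations become colours.
  truthTable : (xs : List A) → (A → Set) → Vec Bool (length xs)
  truthTable []       P = []
  truthTable (x ∷ xs) P = ⌊ em {P x} ⌋ ∷ truthTable xs P

  truthTable-≡ : ∀ {xs : List A} {P Q : A → Set} → truthTable xs P ≡ truthTable xs Q →
                 ∀ {x} → x ∈ xs → P x → Q x
  truthTable-≡ eq (here refl) = ⌊⌋-≡ (cong Vec.head eq)
  truthTable-≡ eq (there x∈)  = truthTable-≡ (cong Vec.tail eq) x∈

  truthTable-cong : ∀ (xs : List A) {P Q : A → Set} → (∀ x → P x → Q x) → (∀ x → Q x → P x) →
                    truthTable xs P ≡ truthTable xs Q
  truthTable-cong []       f g = refl
  truthTable-cong (x ∷ xs) f g = cong₂ _∷_ (⌊⌋-cong (f x) (g x)) (truthTable-cong xs f g)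

  ⊆⇒length≤ : ∀ {xs ys : List A} → Unique xs → (∀ {x} → x ∈ xs → x ∈ ys) → length xs ≤ length ys
  ⊆⇒length≤ {xs = []}     u       s = z≤n
  ⊆⇒length≤ {xs = x ∷ xs} (x∉ ∷ u) s with ∈-∃++ (s (here refl))
  ... | as , bs , refl = ℕ.≤-trans (s≤s (⊆⇒length≤ u s′)) (ℕ.≤-reflexive (sym (length-++-sucʳ as x bs)))
    where
    s′ : ∀ {y} → y ∈ xs → y ∈ as ++ bs
    s′ y∈ with ∈-++⁻ as (s (there y∈))
    ... | inj₁ p          = ∈-++⁺ˡ p
    ... | inj₂ (here refl) = contradiction refl (All.lookup x∉ y∈)
    ... | inj₂ (there p)  = ∈-++⁺ʳ as p

  pigeonhole : ∀ {xs ys : List A} → Unique xs → length ys < length xs → ∃[ x ] x ∈ xs × x ∉ ys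
  pigeonhole {xs = xs} {ys} u l with em {∃[ x ] x ∈ xs × x ∉ ys}
  ... | yes r = r
  ... | no ¬r = contradiction (⊆⇒length≤ u s) (ℕ.<⇒≱ l)
    where
    s : ∀ {x} → x ∈ xs → x ∈ ys
    s {x} x∈ with em {x ∈ ys}
    ... | yes p = p
    ... | no ¬p = ⊥-elim (¬r (x , x∈ , ¬p))

  Unique-map : ∀ {f : A → B} {xs} → (∀ {x y} → x ∈ xs → y ∈ xs → f x ≡ f y → x ≡ y) →
               Unique xs → Unique (map f xs)
  Unique-map inj []       = []
  Unique-map inj (x∉ ∷ u) =
    All.map⁺ (All.tabulate λ y∈ eq → All.lookup x∉ y∈ (inj (here refl) (there y∈) eq)) ∷
    Unique-map (λ x∈ y∈ → inj (there x∈) (there y∈)) u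

  fibre : (A → B) → B → List A → List A
  fibre f b = filter (λ x → em {f x ≡ b})

  fibre-length : ∀ (f : A → B) (g : I → B) b xs ys → map f xs ≡ map g ys →
                 length (fibre f b xs) ≡ length (fibre g b ys)
  fibre-length f g b []       []       eq = refl
  fibre-length f g b (x ∷ xs) (y ∷ ys) eq with em {f x ≡ b} | em {g y ≡ b}
  ... | yes _ | yes _ = cong suc (fibre-length f g b xs ys (∷-injectiveʳ eq))
  ... | no _  | no _  = fibre-length f g b xs ys (∷-injectiveʳ eq)
  ... | yes p | no ¬q = contradiction (trans (sym (∷-injectiveˡ eq)) p) ¬q
  ... | no ¬p | yes q = contradiction (trans (∷-injectiveˡ eq) q) ¬p

  map-≡⇒length≡ : ∀ {f : A → B} {g : I → B} xs ys → map f xs ≡ map g ys → length xs ≡ length ys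
  map-≡⇒length≡ {f = f} {g} xs ys eq = trans (sym (length-map f xs)) (trans (cong length eq) (length-map g ys))

  Unique-∷ : ∀ {x : A} {xs} → x ∉ xs → Unique xs → Unique (x ∷ xs)
  Unique-∷ x∉ u = All.tabulate (λ y∈ eq → x∉ (subst (_∈ _) (sym eq) y∈)) ∷ u

  -- Families with values in a set, compared by the words of bounded length
  -- that their injective tuples spell

  _⊑⟨_⟩_ : (I → A) → ℕ → (J → A) → Set
  κ ⊑⟨ t ⟩ λ′ = ∀ is → Unique is → length is ≤ t → ∃[ js ] Unique js × map κ is ≡ map λ′ js

  wordTable : ∀ X t → (I → ∣ X ∣) → Vec Bool (length (wordsUpTo X t))
  wordTable X t κ = truthTable (wordsUpTo X t) λ w → ∃[ is ] Unique is × length is ≤ t × map κ is ≡ w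

  module _ (X : FinSet) {t : ℕ} {κ : I → ∣ X ∣} {κ′ : J → ∣ X ∣} where

    wordTable-≡⇒⊑ : wordTable X t κ ≡ wordTable X t κ′ → κ ⊑⟨ t ⟩ κ′
    wordTable-≡⇒⊑ eq is u l
      with js , u′ , _ , eq′ ← truthTable-≡ eq
             (∈-wordsUpTo X (map κ is) (ℕ.≤-trans (ℕ.≤-reflexive (length-map κ is)) l)) (is , u , l , refl)
      = js , u′ , sym eq′

    ⊑⇒wordTable-≡ : κ ⊑⟨ t ⟩ κ′ → κ′ ⊑⟨ t ⟩ κ → wordTable X t κ ≡ wordTable X t κ′
    ⊑⇒wordTable-≡ r r′ = truthTable-cong (wordsUpTo X t) (λ _ → transfer r) (λ _ → transfer r′)
      where
      transfer : ∀ {I J : Set} {κ : I → ∣ X ∣} {κ′ : J → ∣ X ∣} {w} → κ ⊑⟨ t ⟩ κ′ →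
        ∃[ is ] Unique is × length is ≤ t × map κ is ≡ w → ∃[ js ] Unique js × length js ≤ t × map κ′ js ≡ w
      transfer r (is , u , l , refl) with r is u l
      ... | js , u′ , eq = js , u′ , subst (_≤ t) (map-≡⇒length≡ is js eq) l , sym eq

  AtLeast : ℕ → (I → Set) → Set
  AtLeast k P = ∃[ xs ] Unique xs × All P xs × k ≤ length xs

  -- Letter by letter: if `κ i` occurs `k` times in `i ∷ is`, then `κ′` has `k` indices with this
  -- letter, while `js` uses only `k` minus one of them, so a fresh one is left.
  ⊑-fromFibres : ∀ {κ : I → A} {κ′ : J → A} {t} →
    (∀ a {k} → k ≤ t → AtLeast k (λ i → κ i ≡ a) → AtLeast k (λ j → κ′ j ≡ a)) → κ ⊑⟨ t ⟩ κ′
  ⊑-fromFibres H [] u l = [] , [] , refl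
  ⊑-fromFibres {κ = κ} {κ′} {t} H (i ∷ is) (i∉ ∷ u) l
    with js , uj , eq ← ⊑-fromFibres {t = t} H is u (ℕ.≤-trans (ℕ.n≤1+n _) l)
    with xs , ux , ax , lx ← H (κ i) (ℕ.≤-trans (s≤s (length-filter _ is)) l)
           ( i ∷ fibre κ (κ i) is
           , (All.tabulate (λ y∈ → All.lookup i∉ (proj₁ (∈-filter⁻ _ y∈))) ∷ Unique.filter⁺ _ u)
           , (refl ∷ All.tabulate (λ y∈ → proj₂ (∈-filter⁻ (λ x → em {κ x ≡ κ i}) {xs = is} y∈)))
           , ℕ.≤-refl)
    with j , j∈ , j∉ ← pigeonhole {ys = fibre κ′ (κ i) js} ux
           (subst (_< length xs) (fibre-length κ κ′ (κ i) is js eq) lx)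
    = j ∷ js
    , (All.tabulate (λ y∈ eq′ → j∉ (∈-filter⁺ _ (subst (_∈ js) (sym eq′) y∈) (All.lookup ax j∈))) ∷ uj)
    , cong₂ _∷_ (sym (All.lookup ax j∈)) eq

  ⊑-map : ∀ {κ : I → A} {κ′ : J → A} {ξ : I → B} {ξ′ : J → B} {t} →
          (∀ i j → κ i ≡ κ′ j → ξ i ≡ ξ′ j) → κ ⊑⟨ t ⟩ κ′ → ξ ⊑⟨ t ⟩ ξ′
  ⊑-map {κ = κ} {κ′} {ξ} {ξ′} f r is u l with js , uj , eq ← r is u l = js , uj , go is js eq
    where
    go : ∀ is js → map κ is ≡ map κ′ js → map ξ is ≡ map ξ′ js
    go []       []       _  = refl
    go (i ∷ is) (j ∷ js) eq = cong₂ _∷_ (f i j (∷-injectiveˡ eq)) (go is js (∷-injectiveʳ eq))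

  abstract
    -- Greedy choice, since `I` may be infinite: a new element is added at most `t` times, unless
    -- none is left.
    exhaust : ∀ t (P : I → Set) →
      ∃[ L ] Unique L × All P L × length L ≤ t × (t ≤ length L ⊎ (∀ i → P i → i ∈ L))
    exhaust zero    P = [] , [] , [] , z≤n , inj₁ z≤n
    exhaust (suc t) P with exhaust t P
    ... | L , u , a , l , inj₂ listed = L , u , a , ℕ.m≤n⇒m≤1+n l , inj₂ listed
    ... | L , u , a , l , inj₁ l′ with em {∃[ i ] P i × i ∉ L}
    ...   | yes (i , p , i∉) =
      i ∷ L , Unique-∷ i∉ u , p ∷ a , s≤s l , inj₁ (s≤s l′)
    ...   | no ¬e = L , u , a , ℕ.m≤n⇒m≤1+n l , inj₂ listed
      where
      listed : ∀ i → P i → i ∈ L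
      listed i p with em {i ∈ L}
      ... | yes i∈ = i∈
      ... | no i∉  = ⊥-elim (¬e (i , p , i∉))

  -- The list `L` then determines the multiplicity of `m` up to `t`.
  Saturated : ℕ → (I → Set) → (I → B) → List I → B → Set
  Saturated t P b L m = t ≤ length (fibre b m L) ⊎ (∀ i → P i → b i ≡ m → i ∈ L)

  abstract
    saturate : ∀ t (P : I → Set) (X : FinSet) (b : I → ∣ X ∣) →
      ∃[ L ] Unique L × All P L × length L ≤ length (elems X) * t × (∀ m → Saturated t P b L m)
    saturate {I} t P X b with go (elems X)
      where
      go : ∀ ms → ∃[ L ] Unique L × All P L × All (λ i → b i ∈ ms) L × length L ≤ length ms * t ×
                  (∀ {m} → m ∈ ms → Saturated t P b L m)
      go [] = [] , [] , [] , [] , z≤n , λ ()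
      -- `elems X` may contain repetitions. A repeated value is skipped, as otherwise the lists
      -- joined below need not be disjoint.
      go (m ∷ ms) with go ms | em {m ∈ ms}
      ... | L , u , a , b∈ , l , s | yes m∈ =
        L , u , a , All.map there b∈ , ℕ.≤-trans l (ℕ.m≤n+m _ t) , λ { (here refl) → s m∈ ; (there p) → s p }
      ... | L , u , a , b∈ , l , s | no m∉ with exhaust t (λ i → P i × b i ≡ m)
      ...   | M , uM , aM , lM , sM =
        M ++ L , Unique.++⁺ uM u disj , All.++⁺ (All.map proj₁ aM) a ,
        All.++⁺ (All.map (here ∘ proj₂) aM) (All.map there b∈) ,
        ℕ.≤-trans (ℕ.≤-reflexive (length-++ M)) (ℕ.+-mono-≤ lM l) , sat
        where
        disj : ∀ {i} → i ∈ M × i ∈ L → ⊥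
        disj (p , q) = m∉ (subst (_∈ ms) (proj₂ (All.lookup aM p)) (All.lookup b∈ q))
    
        sat : ∀ {m′} → m′ ∈ m ∷ ms → Saturated t P b (M ++ L) m′
        sat (here refl) = Sum.map
          (λ l′ → ℕ.≤-trans l′ (⊆⇒length≤ uM λ x∈ → ∈-filter⁺ _ (∈-++⁺ˡ x∈) (proj₂ (All.lookup aM x∈))))
          (λ e i p q → ∈-++⁺ˡ (e i (p , q))) sM
        sat {m′} (there p) with s p
        ... | inj₁ l′ = inj₁ (ℕ.≤-trans l′ (⊆⇒length≤ (Unique.filter⁺ _ u) λ x∈ →
                          let (x∈L , q) = ∈-filter⁻ (λ i → em {b i ≡ m′}) x∈ in ∈-filter⁺ _ (∈-++⁺ʳ M x∈L) q))
        ... | inj₂ e  = inj₂ λ i q r → ∈-++⁺ʳ M (e i q r)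
    ... | L , u , a , _ , l , s = L , u , a , l , λ m → s (complete X m)

  saturated⇒fibre : ∀ {t k} {P : I → Set} {b : I → B} {L m} → Saturated t P b L m → k ≤ t →
    AtLeast k (λ i → P i × b i ≡ m) → k ≤ length (fibre b m L)
  saturated⇒fibre (inj₁ l) k≤t _ = ℕ.≤-trans k≤t l
  saturated⇒fibre (inj₂ e) k≤t (xs , u , a , l) =
    ℕ.≤-trans l (⊆⇒length≤ u λ x∈ → let (p , q) = All.lookup a x∈ in ∈-filter⁺ _ (e _ p q) q)

  zip-exists : ∀ (xs : List A) (ys : List B) → length xs ≡ length ys →
    ∃[ zs ] map proj₁ zs ≡ xs × map proj₂ zs ≡ ys
  zip-exists []       []       _  = [] , refl , refl
  zip-exists (x ∷ xs) (y ∷ ys) eq with zip-exists xs ys (ℕ.suc-injective eq)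
  ... | zs , refl , refl = (x , y) ∷ zs , refl , refl

  Unique-on : ∀ {f : A → B} {zs x y} → Unique (map f zs) → x ∈ zs → y ∈ zs → f x ≡ f y → x ≡ y
  Unique-on (_ ∷ u) (here refl) (here refl) _  = refl
  Unique-on (a ∷ u) (here refl) (there q)   eq = contradiction eq (All.lookup (All.map⁻ a) q)
  Unique-on (a ∷ u) (there p)   (here refl) eq = contradiction (sym eq) (All.lookup (All.map⁻ a) p)
  Unique-on (_ ∷ u) (there p)   (there q)   eq = Unique-on u p q eq

  -- A refinement (κ , b) of a family κ can be copied to a family κ′ with
  -- sufficiently many equal multiplicities: j receives the refinement of
  -- imitate j.
  module _ (X : FinSet) {κ : I → A} {κ′ : J → A} (b : I → ∣ X ∣) {t t′ : ℕ}
           (t≤ : length (elems X) * t < t′) (r : κ ⊑⟨ t′ ⟩ κ′) (r′ : κ′ ⊑⟨ t′ ⟩ κ) where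

    private
      -- The pairs match a saturated part of the n-fibre of κ with a part of the
      -- n-fibre of κ′; when the latter is not everything, some index of the
      -- former fibre is left over.
      record Matching (n : A) : Set where
        field
          pairs     : List (J × I)
          unique₁   : Unique (map proj₁ pairs)
          unique₂   : Unique (map proj₂ pairs)
          values    : ∀ {j i} → (j , i) ∈ pairs → κ′ j ≡ n × κ i ≡ n
          saturated : ∀ m → Saturated t (λ i → κ i ≡ n) b (map proj₂ pairs) m
          leftover  : ∀ {j} → κ′ j ≡ n → j ∉ map proj₁ pairs → ∃[ i ] κ i ≡ n × i ∉ map proj₂ pairs
      open Matching

      matching : ∀ n → Matching n
      matching n with saturate t (λ i → κ i ≡ n) X b
      -- The bound on the length of `L` lies below `t′`, so `r` copies `L` into the `n`-fibre of
      -- `κ′`.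
      ... | L , uL , aL , lL , sL with r L uL (ℕ.<⇒≤ (ℕ.≤-<-trans lL t≤))
      ...   | L′ , uL′ , eq with zip-exists L′ L (sym (map-≡⇒length≡ L L′ eq))
      ...     | Z , refl , refl = record
        { pairs = Z ; unique₁ = uL′ ; unique₂ = uL ; saturated = sL
        ; values = λ z∈ → All.lookup aL′ (∈-map⁺ proj₁ z∈) , All.lookup aL (∈-map⁺ proj₂ z∈)
        ; leftover = left
        }
        where
        aL′ : All (λ j → κ′ j ≡ n) (map proj₁ Z)
        aL′ = All.map⁻ (subst (All (_≡ n)) eq (All.map⁺ aL))

        left : ∀ {j} → κ′ j ≡ n → j ∉ map proj₁ Z → ∃[ i ] κ i ≡ n × i ∉ map proj₂ Z
        -- `j ∷ L′` has one index more than `L`, which is why `t≤` is a strict inequality. Its copy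
        -- in the `n`-fibre of `κ` cannot fit into `L`.
        left {j} κj j∉ with r′ (j ∷ L′) (Unique-∷ j∉ uL′)
                            (ℕ.≤-trans (s≤s (subst (_≤ _) (map-≡⇒length≡ L L′ eq) lL)) t≤)
        ... | is , u , eq′ with pigeonhole {ys = L} u (ℕ.≤-reflexive (trans
                                  (cong suc (map-≡⇒length≡ L L′ eq)) (map-≡⇒length≡ (j ∷ L′) is eq′)))
        ... | i , i∈ , i∉ = i , All.lookup aκ i∈ , i∉
          where
          aκ : All (λ i → κ i ≡ n) is
          aκ = All.map⁻ (subst (All (_≡ n)) eq′ (κj ∷ All.map⁺ aL′))

      -- An unpaired `j` imitates an index outside the saturated part. The refinement of such an
      -- index already occurs `t` times inside that part, so further copies of it are harmless.
      Choice : ∀ n → Matching n → J → I → Set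
      Choice n M j i = (j , i) ∈ pairs M ⊎ i ∉ map proj₂ (pairs M) × j ∉ map proj₁ (pairs M)

      choose : ∀ {n} (M : Matching n) j → κ′ j ≡ n → ∃[ i ] κ i ≡ n × Choice n M j i
      choose M j κj with em {j ∈ map proj₁ (pairs M)}
      ... | yes j∈ with ∈-map⁻ proj₁ j∈
      ...   | (_ , i) , z∈ , refl = i , proj₂ (values M z∈) , inj₁ z∈
      choose M j κj | no j∉ with leftover M κj j∉
      ...   | i , κi , i∉ = i , κi , inj₂ (i∉ , j∉)

    abstract
      imitation : ∀ j → ∃[ i ] κ i ≡ κ′ j × Choice (κ′ j) (matching (κ′ j)) j i
      imitation j = choose (matching (κ′ j)) j refl

    imitate : J → I
    imitate j = proj₁ (imitation j)

    imitate-κ : ∀ j → κ (imitate j) ≡ κ′ j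
    imitate-κ j = proj₁ (proj₂ (imitation j))

    private
      imitate-choice : ∀ {n} j → κ′ j ≡ n → Choice n (matching n) j (imitate j)
      imitate-choice j refl = proj₂ (proj₂ (imitation j))

      -- The paired indices alone are numerous enough, since their partners are saturated and are
      -- imitated exactly.
      forth : ∀ {n} (M : Matching n) → (∀ j → κ′ j ≡ n → Choice n M j (imitate j)) → ∀ m {k} → k ≤ t →
              AtLeast k (λ i → (κ i , b i) ≡ (n , m)) → AtLeast k (λ j → (κ′ j , b (imitate j)) ≡ (n , m))
      forth {n} M ch m {k} k≤t (xs , u , a , l) =
          map proj₁ F
        , Unique-map (λ p q eq → Unique-on (unique₁ M) (proj₁ (z∈ p)) (proj₁ (z∈ q)) eq)
            (Unique.filter⁺ _ (Unique.map⁻ (unique₁ M)))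
        , All.map⁺ (All.tabulate λ {z} p → val (z∈ p))
        , ℕ.≤-trans
            (saturated⇒fibre (saturated M m) k≤t (xs , u , All.map (λ eq → ,-injectiveˡ eq , ,-injectiveʳ eq) a , l))
            (ℕ.≤-reflexive (trans
              (fibre-length b (b ∘ proj₂) m _ (pairs M) (sym (map-∘ (pairs M))))
              (sym (length-map proj₁ F))))
        where
        F = fibre (b ∘ proj₂) m (pairs M)

        z∈ : ∀ {z} → z ∈ F → z ∈ pairs M × b (proj₂ z) ≡ m
        z∈ = ∈-filter⁻ (λ z → em {b (proj₂ z) ≡ m})

        val : ∀ {j i} → (j , i) ∈ pairs M × b i ≡ m → (κ′ j , b (imitate j)) ≡ (n , m)
        val {j} {i} (p , q) with ch j (proj₁ (values M p))
        ... | inj₁ p′ = cong₂ _,_ (proj₁ (values M p))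
                          (trans (cong (b ∘ proj₂) (Unique-on (unique₁ M) p′ p refl)) q)
        ... | inj₂ (_ , j∉) = contradiction (∈-map⁺ proj₁ p) j∉

      back : ∀ {n} (M : Matching n) → (∀ j → κ′ j ≡ n → Choice n M j (imitate j)) → ∀ m {k} → k ≤ t →
             AtLeast k (λ j → (κ′ j , b (imitate j)) ≡ (n , m)) → AtLeast k (λ i → (κ i , b i) ≡ (n , m))
      back {n} M ch m k≤t (xs , u , a , l) with saturated M m
      ... | inj₁ l′ = fibre b m L , Unique.filter⁺ _ (unique₂ M) , All.tabulate val , ℕ.≤-trans k≤t l′
        where
        L = map proj₂ (pairs M)

        val : ∀ {i} → i ∈ fibre b m L → (κ i , b i) ≡ (n , m)
        val p with ∈-filter⁻ (λ i → em {b i ≡ m}) {xs = L} p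
        ... | i∈ , q with ∈-map⁻ proj₂ i∈
        ...   | _ , z∈ , refl = cong₂ _,_ (proj₂ (values M z∈)) q
      -- All indices with refinement `m` lie in the saturated part, so every `j` in `xs` must be
      -- paired, and on pairs imitation is injective.
      ... | inj₂ e = map imitate xs
        , Unique-map (λ p q eq → cong proj₁ (Unique-on (unique₂ M) (z∈ p) (z∈ q) eq)) u
        , All.map⁺ (All.map (λ {j} eq → trans (cong (_, b (imitate j)) (imitate-κ j)) eq) a)
        , subst (_ ≤_) (sym (length-map imitate xs)) l
        where
        z∈ : ∀ {j} → j ∈ xs → (j , imitate j) ∈ pairs M
        z∈ {j} p with ch j (,-injectiveˡ (All.lookup a p))
        ... | inj₁ z∈       = z∈
        ... | inj₂ (i∉ , _) = contradiction
          (e _ (trans (imitate-κ j) (,-injectiveˡ (All.lookup a p))) (,-injectiveʳ (All.lookup a p))) i∉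

    imitate-⊑ : (λ i → κ i , b i) ⊑⟨ t ⟩ (λ j → κ′ j , b (imitate j))
    imitate-⊑ = ⊑-fromFibres λ (n , m) → forth (matching n) imitate-choice m

    imitate-⊒ : (λ j → κ′ j , b (imitate j)) ⊑⟨ t ⟩ (λ i → κ i , b i)
    imitate-⊒ = ⊑-fromFibres λ (n , m) → back (matching n) imitate-choice m

-- Coloured forests of bounded depth and their types.

module Forests (em : ∀ {P : Set} → Dec P) where

  open Families em

  data Forest : ℕ → Set₁ where
    empty : Forest 0
    grow  : ∀ {d} (I : Set) → (I → Forest d) → Forest (suc d)

  Node : ∀ {d} → Forest d → Set
  Node empty      = ⊥
  Node (grow I f) = Σ[ i ∈ I ] Maybe (Node (f i))

  pattern root i    = i , nothing
  pattern below i v = i , just v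

  below-injective : ∀ {I : Set} {N : I → Set} {i} {v w : N i} →
                    _≡_ {A = Σ[ i ∈ I ] Maybe (N i)} (below i v) (below i w) → v ≡ w
  below-injective refl = refl

  module _ (C : FinSet) (t : ℕ) where

    Types : ℕ → FinSet
    Types zero    = Vecᶠ Boolᶠ 0
    Types (suc d) = Vecᶠ Boolᶠ (length (wordsUpTo (C ×ᶠ Types d) t))

    typeOf : ∀ {d} (F : Forest d) → (Node F → ∣ C ∣) → ∣ Types d ∣
    treeTypes : ∀ {d I} (f : I → Forest d) → (Node (grow I f) → ∣ C ∣) → I → ∣ C ×ᶠ Types d ∣

    typeOf empty          col = []
    typeOf (grow {d} I f) col = wordTable (C ×ᶠ Types d) t (treeTypes f col)

    treeTypes f col i = col (root i) , typeOf (f i) (λ v → col (below i v))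

  -- At each level the refinement of a tree is its new root colour together with its new type below.
  -- One threshold serves all levels, hence the maximum.
  recolourBound : FinSet → FinSet → ℕ → ℕ → ℕ
  recolourBound C B t zero    = 0
  recolourBound C B t (suc d) =
    suc (length (elems (B ×ᶠ Types (C ×ᶠ B) t d)) * t) ⊔ recolourBound C B t d

  module _ (C B : FinSet) (t : ℕ) where

    infixl 5 _▹_
    _▹_ : ∀ {N : Set} → (N → ∣ C ∣) → (N → ∣ B ∣) → N → ∣ C ×ᶠ B ∣
    (col ▹ β) v = col v , β v

    -- Tree `j` of `F′` imitates a tree `h j` of `F` with the same root colour and the same type at
    -- `t′`. It takes over the new root colour of `h j`; below the root, induction carries the
    -- recolouring of `h j` over to `j`. Imitation preserves multiplicities up to `t`, so the new
    -- types of the forests agree.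
    recolour : ∀ {d} (F F′ : Forest d) (col : Node F → ∣ C ∣) (col′ : Node F′ → ∣ C ∣) (β : Node F → ∣ B ∣) →
      ∀ {t′} → recolourBound C B t d ≤ t′ → typeOf C t′ F col ≡ typeOf C t′ F′ col′ →
      Σ[ β′ ∈ (Node F′ → ∣ B ∣) ] typeOf (C ×ᶠ B) t F (col ▹ β) ≡ typeOf (C ×ᶠ B) t F′ (col′ ▹ β′)
    recolour empty empty col col′ β _ _ = (λ ()) , refl
    recolour {suc d} (grow I f) (grow J g) col col′ β {t′} t≤ eq =
      β′ , ⊑⇒wordTable-≡ ((C ×ᶠ B) ×ᶠ Types (C ×ᶠ B) t d)
        (⊑-map same (imitate-⊑ X b t< r r′))
        (⊑-map (λ j i e → sym (same i j (sym e))) (imitate-⊒ X b t< r r′))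
      where
      X = B ×ᶠ Types (C ×ᶠ B) t d
      t< = ℕ.m⊔n≤o⇒m≤o _ (recolourBound C B t d) t≤
      r  = wordTable-≡⇒⊑ (C ×ᶠ Types C t′ d) eq
      r′ = wordTable-≡⇒⊑ (C ×ᶠ Types C t′ d) (sym eq)

      b : I → ∣ X ∣
      b i = β (root i) , typeOf (C ×ᶠ B) t (f i) (λ v → (col ▹ β) (below i v))

      h : J → I
      h = imitate X b t< r r′

      h-tree : ∀ j → treeTypes C t′ f col (h j) ≡ treeTypes C t′ g col′ j
      h-tree = imitate-κ X b t< r r′

      IH : ∀ j → _
      IH j = recolour (f (h j)) (g j) (λ v → col (below (h j) v)) (λ v → col′ (below j v)) (λ v → β (below (h j) v))
               (ℕ.m⊔n≤o⇒n≤o (suc (length (elems X) * t)) _ t≤) (,-injectiveʳ (h-tree j))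

      β′ : Node (grow J g) → ∣ B ∣
      β′ (root j)    = β (root (h j))
      β′ (below j v) = proj₁ (IH j) v

      same : ∀ i j → (treeTypes C t′ f col i , b i) ≡ (treeTypes C t′ g col′ j , b (h j)) →
             treeTypes (C ×ᶠ B) t f (col ▹ β) i ≡ treeTypes (C ×ᶠ B) t g (col′ ▹ β′) j
      same i j e = cong₂ _,_
        (cong₂ _,_ (,-injectiveˡ (,-injectiveˡ e)) (,-injectiveˡ (,-injectiveʳ e)))
        (trans (,-injectiveʳ (,-injectiveʳ e)) (proj₂ (IH j)))

  module _ {C : Set} where

    -- Equal depth and equal colours all along the branches from the roots. The colour of the node
    -- alone would say nothing about its ancestors.
    ChainEq : ∀ {d} (F F′ : Forest d) → (Node F → C) → (Node F′ → C) → Node F → Node F′ → Set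
    ChainEq (grow I f) (grow J g) col col′ (root i)    (root j)    = col (root i) ≡ col′ (root j)
    ChainEq (grow I f) (grow J g) col col′ (below i v) (below j w) =
      col (root i) ≡ col′ (root j) × ChainEq (f i) (g j) (λ v → col (below i v)) (λ v → col′ (below j v)) v w
    ChainEq (grow I f) (grow J g) col col′ _           _           = ⊥

    ChainEq-sym : ∀ {d} (F F′ : Forest d) {col col′} v w → ChainEq F F′ col col′ v w → ChainEq F′ F col′ col w v
    ChainEq-sym (grow I f) (grow J g) (root i)    (root j)    eq       = sym eq
    ChainEq-sym (grow I f) (grow J g) (below i v) (below j w) (eq , r) = sym eq , ChainEq-sym (f i) (g j) v w r

    ChainEq-col : ∀ {d} (F F′ : Forest d) {col col′} v w → ChainEq F F′ col col′ v w → col v ≡ col′ w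
    ChainEq-col (grow I f) (grow J g) (root i)    (root j)    eq      = eq
    ChainEq-col (grow I f) (grow J g) (below i v) (below j w) (_ , r) = ChainEq-col (f i) (g j) v w r

  ChainEq-map : ∀ {C D : Set} (π : C → D) {d} (F F′ : Forest d) {col col′} v w →
    ChainEq F F′ col col′ v w → ChainEq F F′ (π ∘ col) (π ∘ col′) v w
  ChainEq-map π (grow I f) (grow J g) (root i)    (root j)    eq       = cong π eq
  ChainEq-map π (grow I f) (grow J g) (below i v) (below j w) (eq , r) = cong π eq , ChainEq-map π (f i) (g j) v w r

  module _ (C : FinSet) {t : ℕ} where

    partner : 1 ≤ t → ∀ {d} (F F′ : Forest d) {col col′} → typeOf C t F col ≡ typeOf C t F′ col′ →
              ∀ v → ∃[ w ] ChainEq F F′ col col′ v w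
    -- The tree containing the partner is prescribed, so that distinct trees can later be shown to
    -- stay distinct.
    partnerBelow : 1 ≤ t → ∀ {d I J} (f : I → Forest d) (g : J → Forest d) {col col′ i j} →
      treeTypes C t f col i ≡ treeTypes C t g col′ j →
      ∀ v → proj₁ v ≡ i → ∃[ w ] proj₁ w ≡ j × ChainEq (grow I f) (grow J g) col col′ v w

    partner 1≤t {suc d} (grow I f) (grow J g) {col} {col′} eq v
      with wordTable-≡⇒⊑ (C ×ᶠ Types C t d) eq (proj₁ v ∷ []) ([] ∷ []) 1≤t
    ... | j ∷ [] , _ , e with partnerBelow 1≤t f g (∷-injectiveˡ e) v refl
    ...   | w , _ , ch = w , ch

    partnerBelow 1≤t f g {j = j} eq (root i)    refl = root j , refl , ,-injectiveˡ eq
    partnerBelow 1≤t f g {j = j} eq (below i v) refl with partner 1≤t (f i) (g j) (,-injectiveʳ eq) v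
    ... | w , ch = below j w , refl , ,-injectiveˡ eq , ch

    -- If two trees of `F′` contained nodes satisfying `P`, the word of length 2 spelled by these
    -- trees would also be spelled by two distinct trees of `F`, each containing such a node. Hence
    -- `2 ≤ t`. Inside a single tree the partners in a tree of equal type yield the same
    -- contradiction, level by level.
    unique-transfer : 2 ≤ t → ∀ {d} (F F′ : Forest d) {col col′} → typeOf C t F col ≡ typeOf C t F′ col′ →
      (P : ∣ C ∣ → Set) → (∀ v v′ → P (col v) → P (col v′) → v ≡ v′) →
      ∀ w w′ → P (col′ w) → P (col′ w′) → w ≡ w′
    unique-transfer 2≤t {suc d} (grow I f) (grow J g) {col} {col′} eq P uniq w w′ pw pw′ = go w w′ pw pw′ same-top
      where
      1≤t = ℕ.≤-trans (s≤s z≤n) 2≤t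
      r′ = wordTable-≡⇒⊑ (C ×ᶠ Types C t d) (sym eq)

      source : ∀ {i} w → P (col′ w) → treeTypes C t g col′ (proj₁ w) ≡ treeTypes C t f col i →
               ∃[ v ] proj₁ v ≡ i × P (col v)
      source w pw e with partnerBelow 1≤t g f {col′} {col} e w refl
      ... | v , tv , ch = v , tv , subst P (ChainEq-col (grow J g) (grow I f) w v ch) pw

      source-top : ∀ {i i′} → treeTypes C t g col′ (proj₁ w) ≡ treeTypes C t f col i →
                   treeTypes C t g col′ (proj₁ w′) ≡ treeTypes C t f col i′ → i ≡ i′
      source-top e e′ =
        let (v  , tv  , pv)  = source w pw e
            (v′ , tv′ , pv′) = source w′ pw′ e′
        in trans (sym tv) (trans (cong proj₁ (uniq v v′ pv pv′)) tv′)

      same-top : proj₁ w ≡ proj₁ w′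
      same-top with em {proj₁ w ≡ proj₁ w′}
      ... | yes p = p
      ... | no ¬p with r′ (proj₁ w ∷ proj₁ w′ ∷ []) ((¬p ∷ []) ∷ [] ∷ []) 2≤t
      ...   | i ∷ i′ ∷ [] , (i≢i′ ∷ _) ∷ _ , e
        = contradiction (source-top (∷-injectiveˡ e) (∷-injectiveˡ (∷-injectiveʳ e))) i≢i′

      go : ∀ w w′ → P (col′ w) → P (col′ w′) → proj₁ w ≡ proj₁ w′ → w ≡ w′
      go w w′ pw pw′ p with r′ (proj₁ w ∷ []) ([] ∷ []) 1≤t
      go (root j) (root j) pw pw′ refl | i ∷ [] , _ , e = refl
      go (root j) (below j w′) pw pw′ refl | i ∷ [] , _ , e
        with partnerBelow 1≤t g f {col′} {col} (∷-injectiveˡ e) (below j w′) refl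
      ... | below i v , refl , ch
        with uniq (root i) (below i v) (subst P (,-injectiveˡ (∷-injectiveˡ e)) pw)
                  (subst P (ChainEq-col (grow J g) (grow I f) {col′} {col} (below j w′) (below i v) ch) pw′)
      ...   | ()
      go (below j w) (root j) pw pw′ refl | i ∷ [] , _ , e
        with partnerBelow 1≤t g f {col′} {col} (∷-injectiveˡ e) (below j w) refl
      ... | below i v , refl , ch
        with uniq (root i) (below i v) (subst P (,-injectiveˡ (∷-injectiveˡ e)) pw′)
                  (subst P (ChainEq-col (grow J g) (grow I f) {col′} {col} (below j w) (below i v) ch) pw)
      ...   | ()
      go (below j w) (below j w′) pw pw′ refl | i ∷ [] , _ , e =
        cong (λ v → below j v) (unique-transfer 2≤t (f i) (g j) {λ v → col (below i v)} {λ w → col′ (below j w)}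
          (sym (,-injectiveʳ (∷-injectiveˡ e))) P
          (λ v v′ pv pv′ → below-injective (uniq (below i v) (below i v′) pv pv′)) w w′ pw pw′)

  -- Ancestors, counted from the root; beyond the node itself the sequence is
  -- constant.
  anc : ∀ {d} (F : Forest d) → Node F → Fin d → Node F
  anc (grow I f) (root i)    _       = root i
  anc (grow I f) (below i v) zero    = root i
  anc (grow I f) (below i v) (suc a) = below i (anc (f i) v a)

  anc-anc : ∀ {d} (F : Forest d) v {a b} → toℕ a ≤ toℕ b → anc F (anc F v b) a ≡ anc F v a
  anc-anc (grow I f) (root i)    {a}     {b}     _       = refl
  anc-anc (grow I f) (below i v) {zero}  {zero}  _       = refl
  anc-anc (grow I f) (below i v) {zero}  {suc b} _       = refl
  anc-anc (grow I f) (below i v) {suc a} {suc b} (s≤s l) = cong (λ v → below i v) (anc-anc (f i) v l)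

  module _ {C : Set} where

    ChainEq-anc : ∀ {d} (F F′ : Forest d) {col : Node F → C} {col′ : Node F′ → C} v w a →
      ChainEq F F′ col col′ v w → ChainEq F F′ col col′ (anc F v a) (anc F′ w a)
    ChainEq-anc (grow I f) (grow J g) (root i)    (root j)    a       ch       = ch
    ChainEq-anc (grow I f) (grow J g) (below i v) (below j w) zero    (eq , _) = eq
    ChainEq-anc (grow I f) (grow J g) (below i v) (below j w) (suc a) (eq , r) = eq , ChainEq-anc (f i) (g j) v w a r

    -- Which positions of a branch coincide depends only on the depth of its node, and `ChainEq`
    -- relates nodes of equal depth.
    anc-transfer : ∀ {d} (F F′ : Forest d) {col : Node F → C} {col′ : Node F′ → C} v w →
      ChainEq F F′ col col′ v w → ∀ m a b →
      anc F′ (anc F′ w m) a ≡ anc F′ w b → anc F (anc F v m) a ≡ anc F v b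
    anc-transfer (grow I f) (grow J g) (root i)    (root j)    _        m       a       b       _  = refl
    anc-transfer (grow I f) (grow J g) (below i v) (below j w) _        zero    a       zero    _  = refl
    anc-transfer (grow I f) (grow J g) (below i v) (below j w) _        (suc m) zero    zero    _  = refl
    anc-transfer (grow I f) (grow J g) (below i v) (below j w) (_ , ch) (suc m) (suc a) (suc b) eq =
      cong (λ v → below i v) (anc-transfer (f i) (g j) v w ch m a b (below-injective eq))

-- Elimination forests of a graph, with connectivity expressed by bounded walks.

module Elimination (em : ∀ {P : Set} → Dec P) (ext : Extensionality 0ℓ 0ℓ) where

  open Families em
  open Forests em

  -- A walk may stop early, so `n` is only an upper bound; for fixed `n` this is a first-order
  -- property.
  Walk : {A : Set} → (A → A → Set) → ℕ → A → A → Set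
  Walk R zero    u v = u ≡ v
  Walk R (suc n) u v = u ≡ v ⊎ ∃[ w ] R u w × Walk R n w v

  module _ {A : Set} {R : A → A → Set} where

    Walk-refl : ∀ n {u} → Walk R n u u
    Walk-refl zero    = refl
    Walk-refl (suc n) = inj₁ refl

    Walk-mono : ∀ {m n u v} → m ≤ n → Walk R m u v → Walk R n u v
    Walk-mono {n = n} z≤n     refl                = Walk-refl n
    Walk-mono         (s≤s l) (inj₁ eq)           = inj₁ eq
    Walk-mono         (s≤s l) (inj₂ (w , r , ws)) = inj₂ (w , r , Walk-mono l ws)

    Walk-++ : ∀ m {n u v w} → Walk R m u v → Walk R n v w → Walk R (m + n) u w
    Walk-++ zero    refl                 q = q
    Walk-++ (suc m) (inj₁ refl)          q = Walk-mono (ℕ.m≤n+m _ (suc m)) q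
    Walk-++ (suc m) (inj₂ (w , r , ws)) q = inj₂ (w , r , Walk-++ m ws q)

  module _ (G : Graph) (B : ℕ) where

    -- InU p is what an elimination forest has to eliminate below the path p
    -- (deepest vertex first): the component of the last vertex of p, without
    -- that vertex.  Conn p is connectivity in InU p once B is large enough.
    InU  : List (V G) → V G → Set
    Step : List (V G) → V G → V G → Set
    Conn : List (V G) → V G → V G → Set

    InU []      v = ⊤
    InU (x ∷ p) v = InU p v × v ≢ x × Conn p x v

    Step p u v = E G u v × InU p v

    Conn p = Walk (Step p) B

    -- This makes `Conn p` an equivalence relation on `InU p`; bounded tree depth will supply it.
    Short : Set
    Short = ∀ p {n u v} → InU p u → Walk (Step p) n u v → Conn p u v

    -- `I` indexes the components of `InU p`, each with a chosen root. The condition on what remains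
    -- below a root is the parameter `Sub`, so that `Elim` can be defined by recursion on the
    -- forest.
    record Layer (p : List (V G)) (I : Set) (Sub : I → V G → Set) : Set where
      field
        rootOf   : I → V G
        root∈    : ∀ i → InU p (rootOf i)
        cover    : ∀ {v} → InU p v → ∃[ i ] Conn p v (rootOf i)
        distinct : ∀ {i j} → Conn p (rootOf i) (rootOf j) → i ≡ j
        sub      : ∀ i → Sub i (rootOf i)

    Elim : List (V G) → ∀ {d} → Forest d → Set
    Elim p empty      = ∀ v → ¬ InU p v
    Elim p (grow I f) = Layer p I (λ i x → Elim (x ∷ p) (f i))

    open Layer

    vert : ∀ {p d} (F : Forest d) → Elim p F → Node F → V G
    vert (grow I f) e (root i)    = rootOf e i
    vert (grow I f) e (below i v) = vert (f i) (sub e i) v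

    -- Padded with false to length D.
    adjacency : ∀ D → List (V G) → V G → Vec Bool D
    adjacency zero    p       x = []
    adjacency (suc D) []      x = false ∷ adjacency D [] x
    adjacency (suc D) (y ∷ p) x = ⌊ em {E G y x} ⌋ ∷ adjacency D p x

    colour : ∀ D {p d} (F : Forest d) → Elim p F → Node F → Vec Bool D
    colour D {p} (grow I f) e (root i)    = adjacency D p (rootOf e i)
    colour D {p} (grow I f) e (below i v) = colour D (f i) (sub e i) v

    vert∈ : ∀ {p d} (F : Forest d) (e : Elim p F) v → InU p (vert F e v)
    vert∈ (grow I f) e (root i)    = root∈ e i
    vert∈ (grow I f) e (below i v) = proj₁ (vert∈ (f i) (sub e i) v)

    module _ (short : Short) where

      Conn-refl : ∀ p {u} → Conn p u u
      Conn-refl p = Walk-refl B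

      Conn-trans : ∀ p {u v w} → InU p u → Conn p u v → Conn p v w → Conn p u w
      Conn-trans p u∈ q r = short p u∈ (Walk-++ B q r)

      edge⇒Conn : ∀ p {u v} → InU p u → InU p v → E G u v → Conn p u v
      edge⇒Conn p u∈ v∈ e = short p {1} u∈ (inj₂ (_ , (e , v∈) , refl))

      Walk⇒InU : ∀ p n {u v} → InU p u → Walk (Step p) n u v → InU p v
      Walk⇒InU p zero    u∈ refl                      = u∈
      Walk⇒InU p (suc n) u∈ (inj₁ refl)               = u∈
      Walk⇒InU p (suc n) u∈ (inj₂ (w , (_ , w∈) , q)) = Walk⇒InU p n w∈ q

      Conn-sym : ∀ p {u v} → InU p u → Conn p u v → Conn p v u
      Conn-sym p u∈ = go B u∈
        where
        go : ∀ n {u v} → InU p u → Walk (Step p) n u v → Conn p v u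
        go zero    u∈ refl                      = Conn-refl p
        go (suc n) u∈ (inj₁ refl)               = Conn-refl p
        go (suc n) u∈ (inj₂ (w , (e , w∈) , q)) =
          Conn-trans p (Walk⇒InU p n w∈ q) (go n w∈ q) (edge⇒Conn p w∈ u∈ (E-sym G e))

      vert-Conn : ∀ {p d I} {f : I → Forest d} (e : Elim p (grow I f)) v →
                  Conn p (rootOf e (proj₁ v)) (vert (grow I f) e v)
      vert-Conn {p} e (root i)            = Conn-refl p
      vert-Conn     {f = f} e (below i v) = proj₂ (proj₂ (vert∈ (f i) (sub e i) v))

      vert-injective : ∀ {p d} (F : Forest d) (e : Elim p F) v w → vert F e v ≡ vert F e w → v ≡ w
      vert-injective {p} (grow I f) e v w eq = go v w eq
        (distinct e (Conn-trans p (root∈ e _) (vert-Conn e v)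
          (Conn-sym p (root∈ e _) (subst (Conn p _) (sym eq) (vert-Conn e w)))))
        where
        go : ∀ v w → vert (grow I f) e v ≡ vert (grow I f) e w → proj₁ v ≡ proj₁ w → v ≡ w
        go (root i)    (root i)    eq refl = refl
        go (root i)    (below i w) eq refl = contradiction (sym eq) (proj₁ (proj₂ (vert∈ (f i) (sub e i) w)))
        go (below i v) (root i)    eq refl = contradiction eq (proj₁ (proj₂ (vert∈ (f i) (sub e i) v)))
        go (below i v) (below i w) eq refl = cong (λ v → below i v) (vert-injective (f i) (sub e i) v w eq)

      vert-surjective : ∀ {p d} (F : Forest d) (e : Elim p F) {x} → InU p x → ∃[ v ] vert F e v ≡ x
      vert-surjective     empty      e {x} x∈ = contradiction x∈ (e x)
      vert-surjective {p} (grow I f) e {x} x∈ with cover e x∈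
      ... | i , c with em {x ≡ rootOf e i}
      ...   | yes eq = root i , sym eq
      ...   | no neq with vert-surjective (f i) (sub e i) (x∈ , neq , Conn-sym p x∈ c)
      ...     | v , eq = below i v , eq

      -- A clique meets only one component, hence only one tree. Apart from the root of that tree it
      -- is a clique in what remains of the component, and the induction continues there unless
      -- nothing is left.
      clique⇒branch : ∀ {p d} (F : Forest d) (e : Elim p F) (Q : V G → Set) → ∃[ x ] Q x →
        (∀ {x} → Q x → InU p x) → (∀ {x y} → Q x → Q y → x ≡ y ⊎ E G x y) →
        ∃[ v ] ∀ {x} → Q x → ∃[ a ] vert F e (anc F v a) ≡ x
      clique⇒branch     empty      e Q (x , q) Q∈ clq = contradiction (Q∈ q) (e x)
      clique⇒branch {p} (grow I f) e Q (x , q) Q∈ clq with cover e (Q∈ q)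
      ... | i , c with em {∃[ y ] Q y × y ≢ rootOf e i}
      ...   | no ¬y = root i , λ {y} qy → zero , sym (only qy)
        where
        only : ∀ {y} → Q y → y ≡ rootOf e i
        only {y} qy with em {y ≡ rootOf e i}
        ... | yes eq = eq
        ... | no neq = contradiction (y , qy , neq) ¬y
      ...   | yes (y , qy , neq) with clique⇒branch (f i) (sub e i) (λ z → Q z × z ≢ rootOf e i) (y , qy , neq)
                                        (λ (qz , z≢) → Q∈ qz , z≢ , connected qz) (λ (q , _) (q′ , _) → clq q q′)
        where
        connected : ∀ {z} → Q z → Conn p (rootOf e i) z
        connected qz with clq q qz
        ... | inj₁ refl = Conn-sym p (Q∈ q) c
        ... | inj₂ xz   = Conn-trans p (root∈ e i) (Conn-sym p (Q∈ q) c) (edge⇒Conn p (Q∈ q) (Q∈ qz) xz)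
      ...     | v , H = below i v , pos
        where
        pos : ∀ {z} → Q z → ∃[ a ] vert (grow I f) e (anc (grow I f) (below i v) a) ≡ z
        pos {z} qz with em {z ≡ rootOf e i}
        ... | yes refl = zero , refl
        ... | no z≢ with H (qz , z≢)
        ...   | a , eq = suc a , eq

      clique⇒positions : ∀ {d r} (F : Forest d) (e : Elim [] F) (t : Vec (V G) (suc r)) →
        (∀ {x y} → x ∈ᵛ t → y ∈ᵛ t → x ≡ y ⊎ E G x y) →
        ∃[ v ] Σ[ as ∈ Vec (Fin d) (suc r) ] Vec.map (λ a → vert F e (anc F v a)) as ≡ t
      clique⇒positions F e t clq with clique⇒branch F e (_∈ᵛ t) (Vec.head t , head∈ t) (λ _ → tt) clq
        where
        head∈ : ∀ {n} (t : Vec (V G) (suc n)) → Vec.head t ∈ᵛ t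
        head∈ (x ∷ t) = here refl
      ... | v , H = v , collect t H
        where
        collect : ∀ {n} (t : Vec (V G) n) → (∀ {x} → x ∈ᵛ t → ∃[ a ] vert F e (anc F v a) ≡ x) →
                  Σ[ as ∈ Vec (Fin _) n ] Vec.map (λ a → vert F e (anc F v a)) as ≡ t
        collect []      H = [] , refl
        collect (x ∷ t) H with H (here refl) | collect t (H ∘ there)
        ... | a , eq | as , eqs = a ∷ as , cong₂ _∷_ eq eqs

      -- Extensionality makes the characteristic function of a component, hence
      -- the vertex chosen from it, independent of the vertex given.
      module Representatives (p : List (V G)) where

        private
          component-of : V G → V G → Bool
          component-of v w = ⌊ em {InU p w × Conn p v w} ⌋

          choose : (V G → Bool) → Maybe (V G)
          choose χ with em {∃[ w ] T (χ w)}
          ... | yes (w , _) = just w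
          ... | no _        = nothing

          choose-T : ∀ χ {w w′} → T (χ w) → choose χ ≡ just w′ → T (χ w′)
          choose-T χ t eq with em {∃[ w ] T (χ w)}
          choose-T χ t refl | yes (_ , t′) = t′

          choose-just : ∀ χ {w} → T (χ w) → ∃[ w′ ] choose χ ≡ just w′
          choose-just χ t with em {∃[ w ] T (χ w)}
          ... | yes (w , _) = w , refl
          ... | no ¬e       = contradiction (_ , t) ¬e

          component-of-≡ : ∀ {v w} → InU p v → InU p w → Conn p v w → component-of v ≡ component-of w
          component-of-≡ v∈ w∈ c = ext λ x → ⌊⌋-cong
            (λ (x∈ , vx) → x∈ , Conn-trans p w∈ (Conn-sym p v∈ c) vx)
            (λ (x∈ , wx) → x∈ , Conn-trans p v∈ c wx)

          IsRep : V G → Set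
          IsRep v = InU p v × choose (component-of v) ≡ just v

        -- Storing the Boolean verdict in place of a proof of `IsRep v` makes representatives equal
        -- as soon as their vertices are.
        Rep : Set
        Rep = Σ[ v ∈ V G ] T ⌊ em {IsRep v} ⌋

        Rep∈ : ∀ (i : Rep) → InU p (proj₁ i)
        Rep∈ (v , t) = proj₁ (toWitness {a? = em {IsRep v}} t)

        Rep-cover : ∀ {v} → InU p v → Σ[ i ∈ Rep ] Conn p v (proj₁ i)
        Rep-cover {v} v∈ with choose-just (component-of v) {v} (fromWitness {a? = em} (v∈ , Conn-refl p))
        ... | w , eq with toWitness {a? = em} (choose-T (component-of v) {v} (fromWitness {a? = em} (v∈ , Conn-refl p)) eq)
        ...   | w∈ , c = (w , fromWitness {a? = em} (w∈ , trans (cong choose (sym (component-of-≡ v∈ w∈ c))) eq)) , c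

        Rep-distinct : ∀ {i j : Rep} → Conn p (proj₁ i) (proj₁ j) → i ≡ j
        Rep-distinct {v , t} {w , t′} c
          with toWitness {a? = em {IsRep v}} t | toWitness {a? = em {IsRep w}} t′
        ... | v∈ , eq | w∈ , eq′
          with just-injective (trans (sym eq) (trans (cong choose (component-of-≡ v∈ w∈ c)) eq′))
        ...   | refl = cong (v ,_) (T-irrelevant t t′)

      module _ {p : List (V G)} (rt : ∀ {v} → InU p v → V G) (rt∈ : ∀ {v} (v∈ : InU p v) → InU p (rt v∈))
               (rt-Conn : ∀ {v} (v∈ : InU p v) → Conn p v (rt v∈)) where

        open Representatives p

        -- Representatives serve only as names of components; the root of a component may be any
        -- vertex connected to its representative.
        assemble : ∀ {Sub : Rep → V G → Set} → (∀ i → Sub i (rt (Rep∈ i))) → Layer p Rep Sub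
        assemble s = record
          { rootOf   = λ i → rt (Rep∈ i)
          ; root∈    = λ i → rt∈ (Rep∈ i)
          ; cover    = λ v∈ → let (i , c) = Rep-cover v∈ in i , Conn-trans p v∈ c (rt-Conn (Rep∈ i))
          ; distinct = λ {i} {j} c → Rep-distinct
              (Conn-trans p (Rep∈ i) (rt-Conn (Rep∈ i))
                (Conn-trans p (rt∈ (Rep∈ i)) c (Conn-sym p (Rep∈ j) (rt-Conn (Rep∈ j)))))
          ; sub      = s
          }

  module _ {G G′ : Graph} {B D : ℕ} where

    adjacency-≡ : ∀ {D p p′ x x′} → length p ≡ length p′ → length p ≤ D →
      adjacency G B D p x ≡ adjacency G′ B D p′ x′ → Pointwise (λ y y′ → E G y x → E G′ y′ x′) p p′
    adjacency-≡ {p = []}    {[]}     _  _       _  = []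
    adjacency-≡ {p = y ∷ p} {y′ ∷ p′} l (s≤s m) eq =
      ⌊⌋-≡ (cong Vec.head eq) ∷ adjacency-≡ (ℕ.suc-injective l) m (cong Vec.tail eq)

    colour⇒path-adjacency : ∀ {p p′ d} (F F′ : Forest d) (e : Elim G B p F) (e′ : Elim G′ B p′ F′) →
      length p ≡ length p′ → length p + d ≤ D → ∀ v w →
      ChainEq F F′ (colour G B D F e) (colour G′ B D F′ e′) v w →
      Pointwise (λ y y′ → E G y (vert G B F e v) → E G′ y′ (vert G′ B F′ e′ w)) p p′
    colour⇒path-adjacency (grow I f) (grow J g) e e′ l m (root i) (root j) eq =
      adjacency-≡ l (ℕ.m+n≤o⇒m≤o _ m) eq
    colour⇒path-adjacency {p} {d = suc d} (grow I f) (grow J g) e e′ l m (below i v) (below j w) (_ , r) =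
      Pointwise.tail (colour⇒path-adjacency (f i) (g j) (Layer.sub e i) (Layer.sub e′ j) (cong suc l)
        (subst (_≤ D) (ℕ.+-suc (length p) d) m) v w r)

    -- The root of a tree heads the path seen by every node below it, so adjacency to it is the
    -- first entry of the path adjacency. Deeper ancestors are reached by induction.
    colour⇒ancestor-adjacency : ∀ {p p′ d} (F F′ : Forest d) (e : Elim G B p F) (e′ : Elim G′ B p′ F′) →
      length p ≡ length p′ → length p + d ≤ D → ∀ v w →
      ChainEq F F′ (colour G B D F e) (colour G′ B D F′ e′) v w → ∀ a →
      E G (vert G B F e (anc F v a)) (vert G B F e v) → E G′ (vert G′ B F′ e′ (anc F′ w a)) (vert G′ B F′ e′ w)
    colour⇒ancestor-adjacency (grow I f) (grow J g) e e′ l m (root i) (root j) ch a loop =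
      contradiction loop (irrefl G refl)
    colour⇒ancestor-adjacency {p} {d = suc d} (grow I f) (grow J g) e e′ l m (below i v) (below j w) (_ , r) zero =
      Pointwise.head (colour⇒path-adjacency (f i) (g j) (Layer.sub e i) (Layer.sub e′ j) (cong suc l)
        (subst (_≤ D) (ℕ.+-suc (length p) d) m) v w r)
    colour⇒ancestor-adjacency {p} {d = suc d} (grow I f) (grow J g) e e′ l m (below i v) (below j w) (_ , r) (suc a) =
      colour⇒ancestor-adjacency (f i) (g j) (Layer.sub e i) (Layer.sub e′ j) (cong suc l)
        (subst (_≤ D) (ℕ.+-suc (length p) d) m) v w r a

    -- Of two nodes on a branch the deeper one, at position `b`, records the adjacency in its
    -- colour; the other is also an ancestor of it.
    colour⇒adjacency-≤ : ∀ {d} (F F′ : Forest d) (e : Elim G B [] F) (e′ : Elim G′ B [] F′) → d ≤ D → ∀ v w →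
      ChainEq F F′ (colour G B D F e) (colour G′ B D F′ e′) v w → ∀ {a b} → toℕ a ≤ toℕ b →
      E G (vert G B F e (anc F v a)) (vert G B F e (anc F v b)) →
      E G′ (vert G′ B F′ e′ (anc F′ w a)) (vert G′ B F′ e′ (anc F′ w b))
    colour⇒adjacency-≤ F F′ e e′ m v w ch {a} {b} a≤b ab =
      subst (λ z → E G′ (vert G′ B F′ e′ z) _) (anc-anc F′ w a≤b)
        (colour⇒ancestor-adjacency F F′ e e′ refl m (anc F v b) (anc F′ w b) (ChainEq-anc F F′ v w b ch) a
          (subst (λ z → E G (vert G B F e z) _) (sym (anc-anc F v a≤b)) ab))

    colour⇒adjacency : ∀ {d} (F F′ : Forest d) (e : Elim G B [] F) (e′ : Elim G′ B [] F′) → d ≤ D → ∀ v w →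
      ChainEq F F′ (colour G B D F e) (colour G′ B D F′ e′) v w → ∀ a b →
      E G (vert G B F e (anc F v a)) (vert G B F e (anc F v b)) →
      E G′ (vert G′ B F′ e′ (anc F′ w a)) (vert G′ B F′ e′ (anc F′ w b))
    colour⇒adjacency F F′ e e′ m v w ch a b ab with ℕ.≤-total (toℕ a) (toℕ b)
    ... | inj₁ a≤b = colour⇒adjacency-≤ F F′ e e′ m v w ch a≤b ab
    ... | inj₂ b≤a = E-sym G′ (colour⇒adjacency-≤ F F′ e e′ m v w ch b≤a (E-sym G ab))

-- The game: GSO sentences depend only on the type of an elimination forest.

module Games (em : ∀ {P : Set} → Dec P) (ext : Extensionality 0ℓ 0ℓ) where

  open Families em
  open Forests em
  open Elimination em ext
  open Semantics Guarded

  Finᶠ : ℕ → FinSet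
  Finᶠ n = record { ∣_∣ = Fin n ; elems = List.allFin n ; complete = ∈-allFin }

  Gaifman-edge : ∀ G {x y} → Gaifman (edgeRel G) x y → E G x y
  Gaifman-edge G (x≢y , a ∷ b ∷ [] , ab , here refl         , here refl)         = contradiction refl x≢y
  Gaifman-edge G (x≢y , a ∷ b ∷ [] , ab , here refl         , there (here refl)) = ab
  Gaifman-edge G (x≢y , a ∷ b ∷ [] , ab , there (here refl) , here refl)         = E-sym G ab
  Gaifman-edge G (x≢y , a ∷ b ∷ [] , ab , there (here refl) , there (here refl)) = contradiction refl x≢y

  edge-Gaifman : ∀ G {x y} → E G x y → Gaifman (edgeRel G) x y
  edge-Gaifman G {x} {y} xy = (λ { refl → irrefl G refl xy }) , x ∷ y ∷ [] , xy , here refl , there (here refl)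

  maximum : ∀ {n r} (as : Vec (Fin n) (suc r)) → ∃[ k ] ∀ l → toℕ (lookup as l) ≤ toℕ (lookup as k)
  maximum (a ∷ [])         = zero , λ { zero → ℕ.≤-refl }
  maximum (a ∷ as@(_ ∷ _)) with maximum as
  ... | k , max with ℕ.≤-total (toℕ a) (toℕ (lookup as k))
  ...   | inj₁ a≤ = suc k , λ { zero → a≤ ; (suc l) → max l }
  ...   | inj₂ ≤a = zero , λ { zero → ℕ.≤-refl ; (suc l) → ℕ.≤-trans (max l) ≤a }

  module _ {X Y Z : Set} {f : X → Z} {g : Y → Z} where

    map-≡⁺ : ∀ {n} (xs : Vec X n) (ys : Vec Y n) → (∀ l → f (lookup xs l) ≡ g (lookup ys l)) →
             Vec.map f xs ≡ Vec.map g ys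
    map-≡⁺ []       []       H = refl
    map-≡⁺ (x ∷ xs) (y ∷ ys) H = cong₂ _∷_ (H zero) (map-≡⁺ xs ys (H ∘ suc))

    map-≡⁻ : ∀ {n} (xs : Vec X n) (ys : Vec Y n) → Vec.map f xs ≡ Vec.map g ys →
             ∀ l → f (lookup xs l) ≡ g (lookup ys l)
    map-≡⁻ (x ∷ xs) (y ∷ ys) eq zero    = cong Vec.head eq
    map-≡⁻ (x ∷ xs) (y ∷ ys) eq (suc l) = map-≡⁻ xs ys (cong Vec.tail eq) l

  ∉-empty : ∀ {X : Set} {x : X} {n} → n ≡ 0 → (xs : Vec X n) → ¬ x ∈ᵛ xs
  ∉-empty refl [] ()

  ∈ᵛ-map⁻ : ∀ {X Y : Set} {f : X → Y} {n} (xs : Vec X n) {y} → y ∈ᵛ Vec.map f xs → ∃[ x ] x ∈ᵛ xs × y ≡ f x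
  ∈ᵛ-map⁻ (x ∷ xs) (here eq) = x , here refl , eq
  ∈ᵛ-map⁻ (_ ∷ xs) (there p) with ∈ᵛ-map⁻ xs p
  ... | x , x∈ , eq = x , there x∈ , eq

  -- A relation on branches of F that depends only on their colours is carried
  -- over to F′ unambiguously.
  consistent : ∀ {C V V′ : Set} {d r} (F F′ : Forest d) (col : Node F → C) (col′ : Node F′ → C)
    (nd : Node F → V) (nd′ : Node F′ → V′) → (∀ {v w} → nd′ v ≡ nd′ w → v ≡ w) → (Q : RelOn V r) →
    (∀ {v v′ w} → ChainEq F F′ col col′ v w → ChainEq F F′ col col′ v′ w → ∀ as →
     Q (Vec.map (nd ∘ anc F v) as) → Q (Vec.map (nd ∘ anc F v′) as)) →
    ∀ {v w v′ w′} → ChainEq F F′ col col′ v w → ChainEq F F′ col col′ v′ w′ → ∀ as bs →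
    Vec.map (nd′ ∘ anc F′ w) as ≡ Vec.map (nd′ ∘ anc F′ w′) bs →
    Q (Vec.map (nd ∘ anc F v) as) → Q (Vec.map (nd ∘ anc F v′) bs)
  consistent {r = zero}  F F′ col col′ nd nd′ inj Q same ch ch′ [] [] _ q = q
  consistent {r = suc r} F F′ col col′ nd nd′ inj Q same {v} {w} {v′} {w′} ch ch′ as bs tup q
    with maximum bs
  -- The deepest entry of the tuple lies on the branches of both `w` and `w′`, and the whole tuple
  -- lies on the branch of that entry. Cutting `v` and `v′` at the corresponding positions gives two
  -- nodes matched with the same node of `F′`, to which `same` applies.
  ... | k , max = subst Q from-v′
    (same (subst (ChainEq F F′ col col′ _) (position k) (ChainEq-anc F F′ v w (lookup as k) ch))
          (ChainEq-anc F F′ v′ w′ (lookup bs k) ch′) bs (subst Q from-v q))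
    where
    position : ∀ l → anc F′ w (lookup as l) ≡ anc F′ w′ (lookup bs l)
    position l = inj (map-≡⁻ as bs tup l)

    from-v : Vec.map (nd ∘ anc F v) as ≡ Vec.map (nd ∘ anc F (anc F v (lookup as k))) bs
    from-v = map-≡⁺ as bs λ l → cong nd (sym (anc-transfer F F′ v w ch (lookup as k) (lookup bs l) (lookup as l)
      (trans (cong (λ u → anc F′ u (lookup bs l)) (position k))
        (trans (anc-anc F′ w′ (max l)) (sym (position l))))))

    from-v′ : Vec.map (nd ∘ anc F (anc F v′ (lookup bs k))) bs ≡ Vec.map (nd ∘ anc F v′) bs
    from-v′ = map-≡⁺ bs bs λ l → cong nd (anc-anc F v′ (max l))

  module _ (B d : ℕ) where

    record Board : Set₁ where
      field
        graph  : Graph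
        forest : Forest d
        elim   : Elim graph B [] forest
        short  : Short graph B

      node : Node forest → V graph
      node = vert graph B forest elim

      ancestor : Node forest → Fin d → V graph
      ancestor v a = node (anc forest v a)

      tuple : ∀ {r} → Node forest → Vec (Fin d) r → Vec (V graph) r
      tuple v as = Vec.map (ancestor v) as

      node-injective : ∀ {v w} → node v ≡ node w → v ≡ w
      node-injective = vert-injective graph B short forest elim _ _

      nodeOf : ∀ x → ∃[ v ] node v ≡ x
      nodeOf x = vert-surjective graph B short forest elim tt

      guarded⇒tuple : ∀ {r} (R : RelOn (V graph) (suc r)) → Guarded graph R → ∀ {t} → R t →
                      ∃[ v ] ∃[ as ] tuple v as ≡ t
      guarded⇒tuple R g {t} Rt = clique⇒positions graph B short forest elim t clique
        where
        clique : ∀ {x y} → x ∈ᵛ t → y ∈ᵛ t → x ≡ y ⊎ E graph x y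
        clique {x} {y} x∈ y∈ with em {x ≡ y}
        ... | yes eq = inj₁ eq
        ... | no neq = inj₂ (Gaifman-edge graph (g (neq , t , Rt , x∈ , y∈)))

    open Board

    module _ {C : Set} (S S′ : Board) (col : Node (forest S) → C) (col′ : Node (forest S′) → C) where

      _≈_ : Node (forest S) → Node (forest S′) → Set
      _≈_ = ChainEq (forest S) (forest S′) col col′

      -- One direction of the invariant; the game maintains it both ways. The fields range over all
      -- pairs of nodes with equal branches, so that any partner of a node may be used. `guarded` is
      -- kept because only guarded tuples can be located on a branch.
      record Sim {n Δ} (ρ : Vec (V (graph S)) n) (ρ′ : Vec (V (graph S′)) n)
                 (σ : All (RelOn (V (graph S))) Δ) (σ′ : All (RelOn (V (graph S′))) Δ) : Set where
        field
          edges   : ∀ {v w} → v ≈ w → ∀ a b → E (graph S) (ancestor S v a) (ancestor S v b) →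
                    E (graph S′) (ancestor S′ w a) (ancestor S′ w b)
          points  : ∀ {v w} → v ≈ w → ∀ j → node S v ≡ lookup ρ j → node S′ w ≡ lookup ρ′ j
          tuples  : ∀ {v w} → v ≈ w → ∀ {r} (X : r ∈ Δ) as →
                    All.lookup σ X (tuple S v as) → All.lookup σ′ X (tuple S′ w as)
          guarded : ∀ {r} (X : r ∈ Δ) → Guarded (graph S) (All.lookup σ X)
          -- In the empty graph, relations of arity 0 are not visible on any branch.
          nullary : ∀ (X : 0 ∈ Δ) → All.lookup σ X [] → All.lookup σ′ X []
    open Sim

    module _ (C : FinSet) (S S′ : Board) {col : Node (forest S) → ∣ C ∣} {col′ : Node (forest S′) → ∣ C ∣}
             {t n Δ} {ρ : Vec (V (graph S)) n} {ρ′ : Vec (V (graph S′)) n}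
             {σ : All (RelOn (V (graph S))) Δ} {σ′ : All (RelOn (V (graph S′))) Δ}
             (eq : typeOf C t (forest S) col ≡ typeOf C t (forest S′) col′)
             (sim : Sim S S′ col col′ ρ ρ′ σ σ′) where

      module _ (1≤t : 1 ≤ t) where

        private
          partner′ : ∀ v → ∃[ w ] ChainEq (forest S) (forest S′) col col′ v w
          partner′ = partner C 1≤t (forest S) (forest S′) eq

          point : ∀ {v w} → ChainEq (forest S) (forest S′) col col′ v w → ∀ a j →
                  ancestor S v a ≡ lookup ρ j → ancestor S′ w a ≡ lookup ρ′ j
          point {v} {w} ch a = points sim (ChainEq-anc (forest S) (forest S′) v w a ch)

        equality-transfer : ∀ i j → lookup ρ i ≡ lookup ρ j → lookup ρ′ i ≡ lookup ρ′ j
        equality-transfer i j e with nodeOf S (lookup ρ i)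
        ... | v , v≡ with partner′ v
        ...   | w , ch = trans (sym (points sim ch i v≡)) (points sim ch j (trans v≡ e))

        edge-transfer : ∀ i j → E (graph S) (lookup ρ i) (lookup ρ j) → E (graph S′) (lookup ρ′ i) (lookup ρ′ j)
        edge-transfer i j e
          with guarded⇒tuple S (edgeRel (graph S)) (λ x → x) {lookup ρ i ∷ lookup ρ j ∷ []} e
        ... | v , a ∷ b ∷ [] , pos with partner′ v
        ...   | w , ch = subst₂ (E (graph S′)) (point ch a i a≡) (point ch b j b≡)
                           (edges sim ch a b (subst₂ (E (graph S)) (sym a≡) (sym b≡) e))
          where
          a≡ = cong Vec.head pos
          b≡ = cong (Vec.head ∘ Vec.tail) pos

        relation-transfer : ∀ {r} (X : r ∈ Δ) is →
          All.lookup σ X (Vec.map (lookup ρ) is) → All.lookup σ′ X (Vec.map (lookup ρ′) is)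
        relation-transfer {zero}  X [] R = nullary sim X R
        relation-transfer {suc r} X is R with guarded⇒tuple S (All.lookup σ X) (guarded sim X) R
        ... | v , as , pos with partner′ v
        ...   | w , ch = subst (All.lookup σ′ X) (move as is pos)
                           (tuples sim ch X as (subst (All.lookup σ X) (sym pos) R))
          where
          move : ∀ {r} (as : Vec _ r) is → tuple S v as ≡ Vec.map (lookup ρ) is → tuple S′ w as ≡ Vec.map (lookup ρ′) is
          move []       []       _   = refl
          move (a ∷ as) (i ∷ is) pos = cong₂ _∷_ (point ch a i (cong Vec.head pos)) (move as is (cong Vec.tail pos))

    positions tables : ℕ → FinSet
    positions r = Vecᶠ (Finᶠ d) r
    tables r    = Vecᶠ Boolᶠ (length (elems (positions r)))

    module _ (C : FinSet) (S S′ : Board) {col : Node (forest S) → ∣ C ∣} {col′ : Node (forest S′) → ∣ C ∣}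
             {t′ n Δ} {ρ : Vec (V (graph S)) n} {ρ′ : Vec (V (graph S′)) n}
             {σ : All (RelOn (V (graph S))) Δ} {σ′ : All (RelOn (V (graph S′))) Δ}
             (eq : typeOf C t′ (forest S) col ≡ typeOf C t′ (forest S′) col′)
             (sim : Sim S S′ col col′ ρ ρ′ σ σ′) (sim′ : Sim S′ S col′ col ρ′ ρ σ′ σ) (t : ℕ) where

      private
        F  = forest S
        F′ = forest S′

      -- The vertex is played as a colour that marks a single node. With `2 ≤ t` the copied colour
      -- also marks exactly one node, which is the answer.
      vertex-move : 2 ≤ t → recolourBound C Boolᶠ t d ≤ t′ → (x : V (graph S)) →
        ∃[ x′ ] ∃[ col₁ ] ∃[ col₁′ ] typeOf (C ×ᶠ Boolᶠ) t F col₁ ≡ typeOf (C ×ᶠ Boolᶠ) t F′ col₁′ ×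
        Sim S S′ col₁ col₁′ (x ∷ ρ) (x′ ∷ ρ′) σ σ′ × Sim S′ S col₁′ col₁ (x′ ∷ ρ′) (x ∷ ρ) σ′ σ
      vertex-move 2≤t t≤ x with nodeOf S x
      ... | v₀ , refl with recolour C Boolᶠ t F F′ col col′ (λ v → ⌊ em {v ≡ v₀} ⌋) t≤ eq
      ... | β′ , eq₁ with partner (C ×ᶠ Boolᶠ) (ℕ.≤-trans (s≤s z≤n) 2≤t) F F′ eq₁ v₀
      ... | w₀ , ch₀ = node S′ w₀ , col₁ , col₁′ , eq₁ , new , new′
        where
        col₁  = λ v → col v , ⌊ em {v ≡ v₀} ⌋
        col₁′ = λ w → col′ w , β′ w

        _≈₁_ = ChainEq F F′ col₁ col₁′

        forget : ∀ {v w} → v ≈₁ w → ChainEq F F′ col col′ v w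
        forget = ChainEq-map proj₁ F F′ _ _

        forget′ : ∀ {w v} → ChainEq F′ F col₁′ col₁ w v → ChainEq F′ F col′ col w v
        forget′ = ChainEq-map proj₁ F′ F _ _

        mark : ∀ {v w} → v ≈₁ w → β′ w ≡ ⌊ em {v ≡ v₀} ⌋
        mark {v} {w} ch = sym (cong proj₂ (ChainEq-col F F′ v w ch))

        marked : ∀ {v w} → v ≈₁ w → v ≡ v₀ → T (β′ w)
        marked ch v≡ = subst T (sym (mark ch)) (fromWitness v≡)

        mark-unique : ∀ w w′ → T (β′ w) → T (β′ w′) → w ≡ w′
        mark-unique = unique-transfer (C ×ᶠ Boolᶠ) 2≤t F F′ eq₁ (T ∘ proj₂)
          λ v v′ p p′ → trans (toWitness p) (sym (toWitness p′))

        new : Sim S S′ col₁ col₁′ (node S v₀ ∷ ρ) (node S′ w₀ ∷ ρ′) σ σ′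
        new = record
          { edges   = edges sim ∘ forget
          ; points  = λ { ch zero    v≡ → cong (node S′)
                                           (mark-unique _ w₀ (marked ch (node-injective S v≡)) (marked ch₀ refl))
                        ; ch (suc j) v≡ → points sim (forget ch) j v≡ }
          ; tuples  = tuples sim ∘ forget
          ; guarded = guarded sim
          ; nullary = nullary sim
          }

        new′ : Sim S′ S col₁′ col₁ (node S′ w₀ ∷ ρ′) (node S v₀ ∷ ρ) σ′ σ
        new′ = record
          { edges   = edges sim′ ∘ forget′
          ; points  = λ { {w} {v} ch zero    w≡ → cong (node S)
                            (toWitness (subst T (mark (ChainEq-sym F′ F w v ch))
                              (subst (T ∘ β′) (sym (node-injective S′ w≡)) (marked ch₀ refl))))
                        ; ch (suc j) w≡ → points sim′ (forget′ ch) j w≡ }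
          ; tuples  = tuples sim′ ∘ forget′
          ; guarded = guarded sim′
          ; nullary = nullary sim′
          }

      -- Tables of R along the branches serve as colours; they are read back
      -- through any branch of F with the same colours.
      module _ {r : ℕ} (R : RelOn (V (graph S)) r) (R-guarded : Guarded (graph S) R) where

        table : Node F → ∣ tables r ∣
        table v = truthTable (elems (positions r)) (λ as → R (tuple S v as))

        relation-move : recolourBound C (tables r) t d ≤ t′ →
          Σ[ R′ ∈ RelOn (V (graph S′)) r ] Guarded (graph S′) R′ ×
          ∃[ col₁ ] ∃[ col₁′ ] typeOf (C ×ᶠ (tables r)) t F col₁ ≡ typeOf (C ×ᶠ (tables r)) t F′ col₁′ ×
          Sim S S′ col₁ col₁′ ρ ρ′ (R ∷ σ) (R′ ∷ σ′) × Sim S′ S col₁′ col₁ ρ′ ρ (R′ ∷ σ′) (R ∷ σ)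
        relation-move t≤ with recolour C (tables r) t F F′ col col′ table t≤ eq
        ... | β′ , eq₁ = R′ , R′-guarded , col₁ , col₁′ , eq₁ , new , new′
          where
          col₁  = λ v → col v , table v
          col₁′ = λ w → col′ w , β′ w

          _≈₁_ = ChainEq F F′ col₁ col₁′

          forget : ∀ {v w} → v ≈₁ w → ChainEq F F′ col col′ v w
          forget = ChainEq-map proj₁ F F′ _ _

          forget′ : ∀ {w v} → ChainEq F′ F col₁′ col₁ w v → ChainEq F′ F col′ col w v
          forget′ = ChainEq-map proj₁ F′ F _ _

          flip : ∀ {w v} → ChainEq F′ F col₁′ col₁ w v → v ≈₁ w
          flip {w} {v} = ChainEq-sym F′ F w v

          R′ : RelOn (V (graph S′)) r
          -- The second disjunct concerns arity 0 only: in an empty forest no branch could witness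
          -- that a nullary relation holds.
          R′ t = (∃[ v ] ∃[ w ] ∃[ as ] v ≈₁ w × tuple S′ w as ≡ t × R (tuple S v as))
               ⊎ (r ≡ 0 × ∃[ as ] R as)

          same-table : ∀ {v v′ w} → v ≈₁ w → v′ ≈₁ w → ∀ as → R (tuple S v as) → R (tuple S v′ as)
          same-table {v} {v′} {w} ch ch′ as = truthTable-≡
            (trans (cong proj₂ (ChainEq-col F F′ v w ch)) (sym (cong proj₂ (ChainEq-col F F′ v′ w ch′))))
            (complete (positions r) as)

          R′-consistent : ∀ {v w v′ w′} → v ≈₁ w → v′ ≈₁ w′ → ∀ as bs →
            tuple S′ w as ≡ tuple S′ w′ bs → R (tuple S v as) → R (tuple S v′ bs)
          R′-consistent = consistent F F′ col₁ col₁′ (node S) (node S′) (node-injective S′) R same-table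

          R′-guarded : Guarded (graph S′) R′
          R′-guarded (x≢y , t , inj₂ (r≡0 , _) , x∈ , _) = ⊥-elim (∉-empty r≡0 t x∈)
          R′-guarded (x≢y , _ , inj₁ (v , w , as , ch , refl , q) , x∈ , y∈)
            with ∈ᵛ-map⁻ as x∈ | ∈ᵛ-map⁻ as y∈
          ... | a , a∈ , refl | b , b∈ , refl = edge-Gaifman (graph S′)
            (edges sim (forget ch) a b (Gaifman-edge (graph S)
              (R-guarded (distinct , tuple S v as , q , ∈ᵛ-map⁺ _ a∈ , ∈ᵛ-map⁺ _ b∈))))
            where
            -- Coinciding positions on the branch of `v` would coincide on that of `w` too, contrary
            -- to `x≢y`; so guardedness of `R` yields an edge in the first graph, which `edges`
            -- carries over.
            distinct : ancestor S v a ≢ ancestor S v b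
            distinct eq = x≢y (cong (node S′) (trans (sym (anc-anc F′ w ℕ.≤-refl))
              (anc-transfer F′ F w v (ChainEq-sym F F′ v w ch) a a b
                (trans (anc-anc F v ℕ.≤-refl) (node-injective S eq)))))

          new : Sim S S′ col₁ col₁′ ρ ρ′ (R ∷ σ) (R′ ∷ σ′)
          new = record
            { edges   = edges sim ∘ forget
            ; points  = points sim ∘ forget
            ; tuples  = λ { ch (here refl) as q → inj₁ (_ , _ , as , ch , refl , q)
                          ; ch (there X) as q → tuples sim (forget ch) X as q }
            ; guarded = λ { (here refl) → R-guarded ; (there X) → guarded sim X }
            ; nullary = λ { (here refl) q → inj₂ (refl , _ , q) ; (there X) q → nullary sim X q }
            }

          new′ : Sim S′ S col₁′ col₁ ρ′ ρ (R′ ∷ σ′) (R ∷ σ)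
          new′ = record
            { edges   = edges sim′ ∘ forget′
            ; points  = points sim′ ∘ forget′
            ; tuples  = λ { ch (here refl) as q → read ch as q
                         ; ch (there X) as q → tuples sim′ (forget′ ch) X as q }
            ; guarded = λ { (here refl) → R′-guarded ; (there X) → guarded sim′ X }
            ; nullary = λ { (here refl) (inj₁ (_ , _ , [] , _ , _ , q)) → q
                          ; (here refl) (inj₂ (_ , [] , q))             → q
                          ; (there X)   q                               → nullary sim′ X q }
            }
            where
            read : ∀ {w v} → ChainEq F′ F col₁′ col₁ w v → ∀ as → R′ (tuple S′ w as) → R (tuple S v as)
            read ch as (inj₁ (_ , _ , bs , ch′ , tup , q)) = R′-consistent ch′ (flip ch) bs as tup q
            read ch [] (inj₂ (refl , [] , q))              = q

    -- Atoms need 1 in order that every node have a partner. A quantifier enlarges the colour set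
    -- before the threshold of its body is taken; the 2 is what keeps a marked node unique.
    threshold : ∀ {n Δ} → Formula (λ _ → ⊤) n Δ → FinSet → ℕ
    threshold (i ≐ j)      C = 1
    threshold (i ~ j)      C = 1
    threshold (X $ is)     C = 1
    threshold (not φ)      C = threshold φ C
    threshold (φ and ψ)    C = threshold φ C ⊔ threshold ψ C
    threshold (φ or ψ)     C = threshold φ C ⊔ threshold ψ C
    threshold (ex φ)       C = recolourBound C Boolᶠ (2 ⊔ threshold φ (C ×ᶠ Boolᶠ)) d
    threshold (all φ)      C = recolourBound C Boolᶠ (2 ⊔ threshold φ (C ×ᶠ Boolᶠ)) d
    threshold (ex₂ r _ φ)  C = recolourBound C (tables r) (threshold φ (C ×ᶠ tables r)) d
    threshold (all₂ r _ φ) C = recolourBound C (tables r) (threshold φ (C ×ᶠ tables r)) d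

    sat-transfer : ∀ {n Δ} (φ : Formula (λ _ → ⊤) n Δ) (C : FinSet) (S S′ : Board)
      {col : Node (forest S) → ∣ C ∣} {col′ : Node (forest S′) → ∣ C ∣} {t} →
      threshold φ C ≤ t → typeOf C t (forest S) col ≡ typeOf C t (forest S′) col′ → ∀ {ρ ρ′ σ σ′} →
      Sim S S′ col col′ ρ ρ′ σ σ′ → Sim S′ S col′ col ρ′ ρ σ′ σ →
      Sat (graph S) ρ σ φ → Sat (graph S′) ρ′ σ′ φ
    sat-transfer (i ≐ j)  C S S′ t≤ eq sim sim′ (lift e) = lift (equality-transfer C S S′ eq sim t≤ i j e)
    sat-transfer (i ~ j)  C S S′ t≤ eq sim sim′ (lift e) = lift (edge-transfer C S S′ eq sim t≤ i j e)
    sat-transfer (X $ is) C S S′ t≤ eq sim sim′ (lift e) = lift (relation-transfer C S S′ eq sim t≤ X is e)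
    -- Negation exchanges the two boards, as universal quantifiers do below; this is why both
    -- directions of `Sim` are carried along.
    sat-transfer (not φ)  C S S′ t≤ eq sim sim′ ¬φ φ′ = ¬φ (sat-transfer φ C S′ S t≤ (sym eq) sim′ sim φ′)
    sat-transfer (φ and ψ) C S S′ t≤ eq sim sim′ (p , q) =
      sat-transfer φ C S S′ (ℕ.m⊔n≤o⇒m≤o _ _ t≤) eq sim sim′ p ,
      sat-transfer ψ C S S′ (ℕ.m⊔n≤o⇒n≤o (threshold φ C) _ t≤) eq sim sim′ q
    sat-transfer (φ or ψ) C S S′ t≤ eq sim sim′ (inj₁ p) =
      inj₁ (sat-transfer φ C S S′ (ℕ.m⊔n≤o⇒m≤o _ _ t≤) eq sim sim′ p)
    sat-transfer (φ or ψ) C S S′ t≤ eq sim sim′ (inj₂ q) =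
      inj₂ (sat-transfer ψ C S S′ (ℕ.m⊔n≤o⇒n≤o (threshold φ C) _ t≤) eq sim sim′ q)
    sat-transfer (ex φ) C S S′ t≤ eq sim sim′ (x , p)
      with vertex-move C S S′ eq sim sim′ _ (ℕ.m≤m⊔n 2 (threshold φ (C ×ᶠ Boolᶠ))) t≤ x
    ... | x′ , _ , _ , eq₁ , new , new′ =
      x′ , sat-transfer φ (C ×ᶠ Boolᶠ) S S′ (ℕ.m≤n⊔m 2 (threshold φ (C ×ᶠ Boolᶠ))) eq₁ new new′ p
    sat-transfer (all φ) C S S′ t≤ eq sim sim′ p x′
      with vertex-move C S′ S (sym eq) sim′ sim _ (ℕ.m≤m⊔n 2 (threshold φ (C ×ᶠ Boolᶠ))) t≤ x′
    ... | x , _ , _ , eq₁ , new′ , new =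
      sat-transfer φ (C ×ᶠ Boolᶠ) S S′ (ℕ.m≤n⊔m 2 (threshold φ (C ×ᶠ Boolᶠ))) (sym eq₁) new new′ (p x)
    sat-transfer (ex₂ r _ φ) C S S′ t≤ eq sim sim′ (R , g , p)
      with relation-move C S S′ eq sim sim′ _ R g t≤
    ... | R′ , g′ , _ , _ , eq₁ , new , new′ =
      R′ , g′ , sat-transfer φ (C ×ᶠ tables r) S S′ ℕ.≤-refl eq₁ new new′ p
    sat-transfer (all₂ r _ φ) C S S′ t≤ eq sim sim′ p R′ g′
      with relation-move C S′ S (sym eq) sim′ sim _ R′ g′ t≤
    ... | R , g , _ , _ , eq₁ , new′ , new =
      sat-transfer φ (C ×ᶠ tables r) S S′ ℕ.≤-refl (sym eq₁) new new′ (p R g)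

    adjacencyᶠ : FinSet
    adjacencyᶠ = Vecᶠ Boolᶠ d

    initial : (S : Board) → Node (forest S) → ∣ adjacencyᶠ ∣
    initial S = colour (graph S) B d (forest S) (elim S)

    initial-sim : ∀ S S′ → Sim S S′ (initial S) (initial S′) [] [] [] []
    initial-sim S S′ = record
      { edges   = λ {v} {w} → colour⇒adjacency (forest S) (forest S′) (elim S) (elim S′) ℕ.≤-refl v w
      ; points  = λ _ ()
      ; tuples  = λ _ ()
      ; guarded = λ ()
      ; nullary = λ ()
      }

    sentence-transfer : ∀ (φ : Formula (λ _ → ⊤) 0 []) (S S′ : Board) →
      let t = threshold φ adjacencyᶠ in
      typeOf adjacencyᶠ t (forest S) (initial S) ≡ typeOf adjacencyᶠ t (forest S′) (initial S′) →
      Sat (graph S) [] [] φ → Sat (graph S′) [] [] φ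
    sentence-transfer φ S S′ eq =
      sat-transfer φ adjacencyᶠ S S′ ℕ.≤-refl eq (initial-sim S S′) (initial-sim S′ S)

-- Describing the type of an elimination forest by finitely many of its roots.

module TypeDescriptions (em : ∀ {P : Set} → Dec P) (ext : Extensionality 0ℓ 0ℓ) where

  open Families em
  open Forests em
  open Elimination em ext

  module _ {I A : Set} {κ : I → A} {t : ℕ} (L : List I) (uL : Unique L)
           (sL : ∀ m → Saturated t (λ _ → ⊤) κ L m) {w : List A} (eq : map κ L ≡ w) where

    private
      letters : List (Fin (length w))
      letters = List.allFin (length w)

      fibres : ∀ a → length (fibre κ a L) ≡ length (fibre (List.lookup w) a letters)
      fibres a = fibre-length κ (List.lookup w) a L letters
        (trans eq (trans (sym (tabulate-lookup w)) (sym (map-tabulate id (List.lookup w)))))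

    -- A saturated list has the multiplicities of the whole family up to `t`, so the word it spells,
    -- read as a family over its positions, stands for `κ`.
    saturated-⊑ : κ ⊑⟨ t ⟩ List.lookup w
    saturated-⊑ = ⊑-fromFibres λ a k≤t (xs , u , al , l) →
      fibre (List.lookup w) a letters , Unique.filter⁺ _ (Unique.allFin⁺ (length w)) ,
      All.tabulate (λ p → proj₂ (∈-filter⁻ (λ x → em {List.lookup w x ≡ a}) {xs = letters} p)) ,
      subst (_ ≤_) (fibres a) (saturated⇒fibre (sL a) k≤t (xs , u , All.map (tt ,_) al , l))

    saturated-⊒ : List.lookup w ⊑⟨ t ⟩ κ
    saturated-⊒ = ⊑-fromFibres λ a k≤t (xs , u , al , l) →
      fibre κ a L , Unique.filter⁺ _ uL ,
      All.tabulate (λ p → proj₂ (∈-filter⁻ (λ x → em {κ x ≡ a}) {xs = L} p)) ,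
      ℕ.≤-trans l (subst (_ ≤_) (sym (fibres a)) (⊆⇒length≤ u λ x∈ → ∈-filter⁺ _ (∈-allFin _) (All.lookup al x∈)))

  module _ (D t : ℕ) where

    Colourᶠ : FinSet
    Colourᶠ = Vecᶠ Boolᶠ D

    Typeᶠ : ℕ → FinSet
    Typeᶠ = Types Colourᶠ t

    Letterᶠ : ℕ → FinSet
    Letterᶠ d = Colourᶠ ×ᶠ Typeᶠ d

    Word : ℕ → Set
    Word d = List ∣ Letterᶠ d ∣

    -- The length bound is the one that `saturate` guarantees.
    saturatedWords : ∀ d → List (Word d)
    saturatedWords d = wordsUpTo (Letterᶠ d) (length (elems (Letterᶠ d)) * t)

    -- The type of a forest whose trees have the types listed in w.
    wordType : ∀ d → Word d → ∣ Typeᶠ (suc d) ∣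
    wordType d w = wordTable (Letterᶠ d) t (List.lookup w)

    frequent : ∀ d → Word d → List ∣ Letterᶠ d ∣
    frequent d w = filter (λ a → t ≤? length (fibre id a w)) (elems (Letterᶠ d))

    module _ (G : Graph) (B : ℕ) where

      private
        U  = InU G B
        Cn = Conn G B

      -- HasType d p τ says in first-order terms that there is an elimination forest
      -- of type τ below p: a word of type τ is spelled by some of its trees, whose
      -- roots are chosen one after the other (xs being those already chosen), and
      -- the letters of all other trees are frequent in that word.

      HasType : ∀ d → List (V G) → ∣ Typeᶠ d ∣ → Set
      IsRoot  : ∀ d → List (V G) → ∣ Letterᶠ d ∣ → V G → Set
      Roots   : ∀ d → List (V G) → List ∣ Letterᶠ d ∣ → Word d → List (V G) → Set

      HasType zero    p τ = ∀ v → ¬ U p v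
      HasType (suc d) p τ = Any (λ w → wordType d w ≡ τ × Roots d p (frequent d w) w []) (saturatedWords d)

      IsRoot d p (c , τ) x = U p x × adjacency G B D p x ≡ c × HasType d (x ∷ p) τ

      Roots d p as []      xs = ∀ y → U p y → Any (Cn p y) xs ⊎ ∃[ x ] Cn p y x × Any (λ a → IsRoot d p a x) as
      Roots d p as (a ∷ w) xs = ∃[ x ] IsRoot d p a x × All (λ x′ → ¬ Cn p x x′) xs × Roots d p as w (x ∷ xs)

      ElimOfType : ∀ d → List (V G) → ∣ Typeᶠ d ∣ → Set₁
      ElimOfType d p τ = Σ[ F ∈ Forest d ] Σ[ e ∈ Elim G B p F ] typeOf Colourᶠ t F (colour G B D F e) ≡ τ

      module _ (short : Short G B) where

        open Layer

        complete-type : ∀ d p τ → ElimOfType d p τ → HasType d p τ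
        complete-type zero    p τ (empty , e , eq) = e
        complete-type (suc d) p τ (grow I f , e , eq)
          with saturate t (λ _ → ⊤) (Letterᶠ d) (treeTypes Colourᶠ t f (colour G B D (grow I f) e))
        ... | L , uL , _ , lL , sL =
          lose (∈-wordsUpTo (Letterᶠ d) w (subst (_≤ _) (sym (length-map κ L)) lL))
               ( trans (sym word-type) eq
               , roots L [] uL (All.tabulate λ _ ()) (λ i∈ → inj₂ i∈))
          where
          κ = treeTypes Colourᶠ t f (colour G B D (grow I f) e)
          w = map κ L

          word-type : typeOf Colourᶠ t (grow I f) (colour G B D (grow I f) e) ≡ wordType d w
          word-type = ⊑⇒wordTable-≡ (Letterᶠ d)
            (saturated-⊑ L uL sL refl) (saturated-⊒ L uL sL refl)

          isRoot : ∀ i → IsRoot d p (κ i) (rootOf e i)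
          isRoot i = root∈ e i , refl , complete-type d (rootOf e i ∷ p) _ (f i , sub e i , refl)

          roots : ∀ L₂ L₁ → Unique L₂ → All (λ i → i ∉ L₁) L₂ → (∀ {i} → i ∈ L → i ∈ L₁ ⊎ i ∈ L₂) →
                  Roots d p (frequent d w) (map κ L₂) (map (rootOf e) L₁)
          roots [] L₁ u new cov y y∈ with cover e y∈
          -- Either all trees with this letter were put into `L`, hence `y` belongs to a chosen
          -- tree, or the letter occurs at least `t` times in `w` and is frequent.
          ... | i , c with sL (κ i)
          ...   | inj₂ lst with cov (lst i tt refl)
          ...     | inj₁ i∈ = inj₁ (lose (∈-map⁺ (rootOf e) i∈) c)
          roots [] L₁ u new cov y y∈ | i , c | inj₁ l = inj₂ (rootOf e i , c ,
            lose (∈-filter⁺ _ (complete (Letterᶠ d) (κ i))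
                   (subst (t ≤_) (fibre-length κ id (κ i) L w (sym (map-id w))) l))
                 (isRoot i))
          roots (i ∷ L₂) L₁ (i∉ ∷ u) (i∉₁ ∷ new) cov =
            rootOf e i , isRoot i ,
            All.map⁺ (All.tabulate λ j∈ c → i∉₁ (subst (_∈ L₁) (sym (distinct e c)) j∈)) ,
            roots L₂ (i ∷ L₁) u
              (All.tabulate λ j∈ → λ { (here refl) → contradiction refl (All.lookup i∉ j∈)
                                     ; (there p)   → All.lookup new j∈ p })
              (λ j∈ → case-∷ (cov j∈))
            where
            case-∷ : ∀ {j} → j ∈ L₁ ⊎ j ∈ i ∷ L₂ → j ∈ i ∷ L₁ ⊎ j ∈ L₂
            case-∷ (inj₁ p)         = inj₁ (there p)
            case-∷ (inj₂ (here eq)) = inj₁ (here eq)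
            case-∷ (inj₂ (there p)) = inj₂ p

        -- The nested quantifiers of `Roots` flattened into one list of roots with their letters,
        -- pairwise in different components.
        record Witnesses (d : ℕ) (p : List (V G)) (as : List ∣ Letterᶠ d ∣) (w : Word d) (xs : List (V G)) : Set where
          field
            found  : List (V G × ∣ Letterᶠ d ∣)
            spell  : map proj₂ found ≡ w
            valid  : All (λ (x , a) → IsRoot d p a x) found
            apart  : AllPairs (λ z z′ → ¬ Cn p (proj₁ z′) (proj₁ z)) found
            apart′ : All (λ z → All (λ x → ¬ Cn p (proj₁ z) x) xs) found
            rest   : ∀ y → U p y → Any (Cn p y) xs ⊎ Any (λ z → Cn p y (proj₁ z)) found ⊎
                     ∃[ x ] Cn p y x × Any (λ a → IsRoot d p a x) as
        open Witnesses

        witnesses : ∀ d p as w xs → Roots d p as w xs → Witnesses d p as w xs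
        witnesses d p as []      xs R = record
          { found = [] ; spell = refl ; valid = [] ; apart = [] ; apart′ = []
          ; rest = λ y y∈ → Sum.map₂ inj₂ (R y y∈) }
        witnesses d p as (a ∷ w) xs (x , r , ap , R) = let W = witnesses d p as w (x ∷ xs) R in record
          { found  = (x , a) ∷ found W
          ; spell  = cong (a ∷_) (spell W)
          ; valid  = r ∷ valid W
          ; apart  = All.map All.head (apart′ W) ∷ apart W
          ; apart′ = ap ∷ All.map All.tail (apart′ W)
          ; rest   = λ y y∈ → reassoc (rest W y y∈)
          }
          where
          reassoc : ∀ {P : V G → Set} {zs : List (V G × ∣ Letterᶠ d ∣)} {R : Set} →
            Any P (x ∷ xs) ⊎ Any (P ∘ proj₁) zs ⊎ R → Any P xs ⊎ Any (P ∘ proj₁) ((x , a) ∷ zs) ⊎ R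
          reassoc (inj₁ (here p))    = inj₂ (inj₁ (here p))
          reassoc (inj₁ (there p))   = inj₁ p
          reassoc (inj₂ (inj₁ p))    = inj₂ (inj₁ (there p))
          reassoc (inj₂ (inj₂ r))    = inj₂ (inj₂ r)

        -- A component containing a witness is eliminated from that witness, any other component
        -- from a root with a frequent letter. The components of the former kind spell `w`, and
        -- those of the latter cannot spoil saturation, so the forest has the type of `w`.
        sound-type : ∀ d p τ → HasType d p τ → ElimOfType d p τ
        sound-type zero    p [] H = empty , H , refl
        sound-type (suc d) p τ H with find H
        ... | w , _ , refl , R = grow Rep trees , layer , trans (⊑⇒wordTable-≡ (Letterᶠ d)
            (saturated-⊑ L uL sL spell-L) (saturated-⊒ L uL sL spell-L)) refl
          where
          open Representatives G B short p
          W = witnesses d p (frequent d w) w [] R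

          record Choice {v} (v∈ : U p v) : Set where
            field
              rt   : V G
              lt   : ∣ Letterᶠ d ∣
              link : Cn p v rt
              isrt : IsRoot d p lt rt
              src  : (rt , lt) ∈ found W ⊎ (lt ∈ frequent d w × ¬ Any (λ z → Cn p v (proj₁ z)) (found W))
          open Choice

          choice : ∀ {v} (v∈ : U p v) → Choice v∈
          choice {v} v∈ with em {Any (λ z → Cn p v (proj₁ z)) (found W)}
          ... | yes any with find any
          ...   | (x , a) , z∈ , c = record { rt = x ; lt = a ; link = c ; isrt = All.lookup (valid W) z∈ ; src = inj₁ z∈ }
          choice {v} v∈ | no ¬any with rest W v v∈
          ... | inj₂ (inj₁ any) = contradiction any ¬any
          ... | inj₂ (inj₂ (x , c , any)) with find any
          ...   | a , a∈ , r = record { rt = x ; lt = a ; link = c ; isrt = r ; src = inj₂ (a∈ , ¬any) }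

          chosen : (i : Rep) → Choice (Rep∈ i)
          chosen i = choice (Rep∈ i)

          below-chosen : ∀ i → ElimOfType d (rt (chosen i) ∷ p) (proj₂ (lt (chosen i)))
          below-chosen i = sound-type d _ _ (proj₂ (proj₂ (isrt (chosen i))))

          trees : Rep → Forest d
          trees i = proj₁ (below-chosen i)

          layer : Layer G B p Rep (λ i x → Elim G B (x ∷ p) (trees i))
          layer = assemble G B short (λ v∈ → rt (choice v∈)) (λ v∈ → proj₁ (isrt (choice v∈)))
                    (λ v∈ → link (choice v∈)) (λ i → proj₁ (proj₂ (below-chosen i)))

          κ : Rep → ∣ Letterᶠ d ∣
          κ = treeTypes Colourᶠ t trees (colour G B D (grow Rep trees) layer)

          κ-lt : ∀ i → κ i ≡ lt (chosen i)
          κ-lt i = cong₂ _,_ (proj₁ (proj₂ (isrt (chosen i)))) (proj₂ (proj₂ (below-chosen i)))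

          repOf : ∀ {z} → z ∈ found W → Σ[ i ∈ Rep ] Cn p (proj₁ z) (proj₁ i)
          repOf z∈ = Rep-cover (proj₁ (All.lookup (valid W) z∈))

          root-in : ∀ {z} → z ∈ found W → U p (proj₁ z)
          root-in z∈ = proj₁ (All.lookup (valid W) z∈)

          same-root : ∀ {zs z z′} → AllPairs (λ z z′ → ¬ Cn p (proj₁ z′) (proj₁ z)) zs → z ∈ zs → z′ ∈ zs →
                      U p (proj₁ z) → Cn p (proj₁ z) (proj₁ z′) → z ≡ z′
          same-root (_ ∷ ap) (here refl) (here refl) z∈ c = refl
          same-root (a ∷ ap) (here refl) (there q)   z∈ c = contradiction (Conn-sym G B short p z∈ c) (All.lookup a q)
          same-root (a ∷ ap) (there q)   (here refl) z∈ c = contradiction c (All.lookup a q)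
          same-root (_ ∷ ap) (there q)   (there q′)  z∈ c = same-root ap q q′ z∈ c

          κ-found : ∀ {z i} → z ∈ found W → Cn p (proj₁ z) (proj₁ i) → κ i ≡ proj₂ z
          κ-found {z} {i} z∈ c with src (chosen i)
          ... | inj₁ z′∈ = trans (κ-lt i) (sym (cong proj₂
            (same-root (apart W) z∈ z′∈ (root-in z∈) (Conn-trans G B short p (root-in z∈) c (link (chosen i))))))
          ... | inj₂ (_ , ¬any) = contradiction (lose z∈ (Conn-sym G B short p (root-in z∈) c)) ¬any

          -- Witnesses are vertices while trees are indexed by representatives; since the witnesses
          -- are pairwise unconnected, passing to representatives keeps them distinct.
          reps : ∀ zs → (∀ {z} → z ∈ zs → z ∈ found W) → AllPairs (λ z z′ → ¬ Cn p (proj₁ z′) (proj₁ z)) zs →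
                 ∃[ L ] Unique L × map κ L ≡ map proj₂ zs ×
                 All (λ i → ∃[ z ] z ∈ zs × Cn p (proj₁ z) (proj₁ i)) L ×
                 (∀ {z} → z ∈ zs → ∃[ i ] i ∈ L × Cn p (proj₁ z) (proj₁ i))
          reps []       in-W ap = [] , [] , refl , [] , λ ()
          reps (z ∷ zs) in-W (az ∷ ap) with reps zs (in-W ∘ there) ap | repOf (in-W (here refl))
          ... | L , uL , spL , aL , cov | i , c =
            i ∷ L , Unique-∷ i∉ uL , cong₂ _∷_ (κ-found (in-W (here refl)) c) spL ,
            (z , here refl , c) ∷ All.map (λ (z , z∈ , c) → z , there z∈ , c) aL ,
            λ { (here refl) → i , here refl , c ; (there z∈) → let (i , i∈ , c) = cov z∈ in i , there i∈ , c }

            where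
            i∉ : i ∉ L
            i∉ i∈ with All.lookup aL i∈
            ... | z′ , z′∈ , c′ = All.lookup az z′∈
              (Conn-trans G B short p (root-in (in-W (there z′∈))) c′ (Conn-sym G B short p (root-in (in-W (here refl))) c))

          L       = proj₁ (reps (found W) id (apart W))
          uL      = proj₁ (proj₂ (reps (found W) id (apart W)))
          spell-L = trans (proj₁ (proj₂ (proj₂ (reps (found W) id (apart W))))) (spell W)
          cover-L = proj₂ (proj₂ (proj₂ (proj₂ (reps (found W) id (apart W)))))

          sL : ∀ m → Saturated t (λ _ → ⊤) κ L m
          sL m with em {t ≤ length (fibre κ m L)}
          ... | yes l = inj₁ l
          ... | no ¬l = inj₂ listed
            where
            listed : ∀ i → ⊤ → κ i ≡ m → i ∈ L
            listed i _ refl with src (chosen i)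
            ... | inj₁ z∈ with cover-L z∈
            ...   | j , j∈ , c = subst (_∈ L) (sym (Rep-distinct {i} {j}
                                   (Conn-trans G B short p (Rep∈ i) (link (chosen i)) c))) j∈
            -- Without a witness in its component, `i` has a frequent letter, which then occurs `t`
            -- times in `L`, contrary to `¬l`.
            listed i _ refl | inj₂ (a∈ , _) = contradiction
              (subst (t ≤_) (sym (fibre-length κ id (κ i) L w (trans spell-L (sym (map-id w)))))
                (subst (λ a → t ≤ length (fibre id a w)) (sym (κ-lt i))
                  (proj₂ (∈-filter⁻ (λ a → t ≤? length (fibre id a w)) {xs = elems (Letterᶠ d)} a∈)))) ¬l

-- First-order formulas for types.

module TypeFormulas (em : ∀ {P : Set} → Dec P) (ext : Extensionality 0ℓ 0ℓ) where

  open Families em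
  open Forests em
  open Elimination em ext
  open TypeDescriptions em ext
  open Semantics Arbitrary

  FO-Formula : ℕ → Set
  FO-Formula n = Formula (λ _ → ⊥) n []

  falsê : ∀ {n} → FO-Formula n
  falsê = ex (not (zero ≐ zero))

  disjunction : ∀ {A : Set} {n} → List A → (A → FO-Formula n) → FO-Formula n
  disjunction []       φ = falsê
  disjunction (a ∷ as) φ = φ a or disjunction as φ

  -- For conditions that do not mention the graph: they are decided when the formula is built.
  provided : ∀ {P : Set} {n} → Dec P → FO-Formula n → FO-Formula n
  provided (yes _) φ = φ
  provided (no _)  φ = falsê

  anyOf allOf : ∀ {n k} → Vec (Fin n) k → (Fin n → FO-Formula n) → FO-Formula n
  anyOf []       φ = falsê
  anyOf (x ∷ xs) φ = φ x or anyOf xs φ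
  allOf []       φ = not falsê
  allOf (x ∷ xs) φ = φ x and allOf xs φ

  ↑ : ∀ {n k} → Vec (Fin n) k → Vec (Fin (suc n)) k
  ↑ = Vec.map suc

  module _ (B : ℕ) where

    inU  : ∀ {k n} → Vec (Fin n) k → Fin n → FO-Formula n
    walk : ∀ {k n} → Vec (Fin n) k → ℕ → Fin n → Fin n → FO-Formula n

    inU []      v = not falsê
    inU (x ∷ p) v = inU p v and (not (v ≐ x) and walk p B x v)

    walk p zero    u v = u ≐ v
    walk p (suc m) u v = (u ≐ v) or ex (((suc u ~ zero) and inU (↑ p) zero) and walk (↑ p) m zero (suc v))

    adjacent : ∀ {k n} D → Vec (Fin n) k → Fin n → Vec Bool D → FO-Formula n
    adjacent zero    p       x []          = not falsê
    adjacent (suc D) []      x (true ∷ c)  = falsê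
    adjacent (suc D) []      x (false ∷ c) = adjacent D [] x c
    adjacent (suc D) (y ∷ p) x (true ∷ c)  = (y ~ x) and adjacent D p x c
    adjacent (suc D) (y ∷ p) x (false ∷ c) = not (y ~ x) and adjacent D p x c

    module _ (D t : ℕ) where

      hasType : ∀ d {k n} → Vec (Fin n) k → ∣ Typeᶠ D t d ∣ → FO-Formula n
      isRoot  : ∀ d {k n} → Vec (Fin n) k → ∣ Letterᶠ D t d ∣ → Fin n → FO-Formula n
      roots   : ∀ d {k m n} → Vec (Fin n) k → List ∣ Letterᶠ D t d ∣ → Word D t d → Vec (Fin n) m → FO-Formula n

      hasType zero    p τ = all (not (inU (↑ p) zero))
      hasType (suc d) p τ = disjunction (saturatedWords D t d) λ w →
        provided (em {wordType D t d w ≡ τ}) (roots d p (frequent D t d w) w [])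

      isRoot d p (c , τ) x = inU p x and (adjacent D p x c and hasType d (x ∷ p) τ)

      roots d p as []      xs = all (not (inU (↑ p) zero) or
        (anyOf (↑ xs) (λ x → walk (↑ p) B zero x) or
         ex (walk (↑ (↑ p)) B (suc zero) zero and disjunction as (λ a → isRoot d (↑ (↑ p)) a zero))))
      roots d p as (a ∷ w) xs = ex (isRoot d (↑ p) a zero and
        (allOf (↑ xs) (λ x → not (walk (↑ p) B zero x)) and roots d (↑ p) as w (zero ∷ ↑ xs)))

    module _ (G : Graph) where

      _⊨ₙ_ : ∀ {n} → Vec (V G) n → FO-Formula n → Set₁
      ρ ⊨ₙ φ = Sat G ρ [] φ

      ⟦_⟧ : ∀ {k n} → Vec (Fin n) k → Vec (V G) n → List (V G)
      ⟦ p ⟧ ρ = Vec.toList (Vec.map (lookup ρ) p)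

      ⟦↑⟧ : ∀ {k n} (p : Vec (Fin n) k) {ρ : Vec (V G) n} {x} → ⟦ ↑ p ⟧ (x ∷ ρ) ≡ ⟦ p ⟧ ρ
      ⟦↑⟧ p = cong Vec.toList (sym (Vec.map-∘ _ suc p))

      false-sat : (Σ[ x ∈ V G ] ¬ Lift (Level.suc 0ℓ) (x ≡ x)) → ⊥
      false-sat (_ , ¬e) = ¬e (lift refl)

      true-sat : (¬ (Σ[ x ∈ V G ] ¬ Lift (Level.suc 0ℓ) (x ≡ x))) ⇔ ⊤
      true-sat = mk⇔ (λ _ → tt) (λ _ → false-sat)

      lift-⇔ : ∀ {P : Set} → Lift (Level.suc 0ℓ) P ⇔ P
      lift-⇔ = mk⇔ lower lift

      not-⇔ : ∀ {P : Set} {Q : Set₁} → Q ⇔ P → (¬ Q) ⇔ (¬ P)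
      not-⇔ e = mk⇔ (_∘ from e) (_∘ to e)

      ex-⇔ : ∀ {P : V G → Set} {Q : V G → Set₁} → (∀ x → Q x ⇔ P x) → (∃[ x ] Q x) ⇔ (∃[ x ] P x)
      ex-⇔ e = mk⇔ (λ (x , q) → x , to (e x) q) (λ (x , p) → x , from (e x) p)

      or-⇔ : ∀ {P P′ : Set} {Q Q′ : Set₁} → Q ⇔ P → Q′ ⇔ P′ → (Q ⊎ Q′) ⇔ (P ⊎ P′)
      or-⇔ e e′ = mk⇔ (Sum.map (to e) (to e′)) (Sum.map (from e) (from e′))

      and-⇔ : ∀ {P P′ : Set} {Q Q′ : Set₁} → Q ⇔ P → Q′ ⇔ P′ → (Q × Q′) ⇔ (P × P′)
      and-⇔ e e′ = mk⇔ (λ (q , q′) → to e q , to e′ q′) (λ (p , p′) → from e p , from e′ p′)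

      guard-⇔ : ∀ {P Q : Set} {P′ Q′ : Set₁} → P′ ⇔ P → Q′ ⇔ Q → ((¬ P′) ⊎ Q′) ⇔ (P → Q)
      guard-⇔ {P} {Q} {P′} {Q′} e e′ = mk⇔
        (λ { (inj₁ ¬p) p → contradiction (from e p) ¬p ; (inj₂ q) _ → to e′ q }) back
        where
        back : (P → Q) → (¬ P′) ⊎ Q′
        back f with em {P}
        ... | yes p = inj₂ (from e′ (f p))
        ... | no ¬p = inj₁ (¬p ∘ to e)

      module _ {n} {ρ : Vec (V G) n} where

        disjunction-sat : ∀ {A : Set} {φ : A → FO-Formula n} {P : A → Set} → (∀ a → ρ ⊨ₙ φ a ⇔ P a) →
                          ∀ as → ρ ⊨ₙ disjunction as φ ⇔ Any P as
        disjunction-sat e []       = mk⇔ (⊥-elim ∘ false-sat) (λ ())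
        disjunction-sat e (a ∷ as) = mk⇔
          (λ { (inj₁ q) → here (to (e a) q) ; (inj₂ q) → there (to (disjunction-sat e as) q) })
          (λ { (here p) → inj₁ (from (e a) p) ; (there p) → inj₂ (from (disjunction-sat e as) p) })

        provided-sat : ∀ {P Q : Set} {φ} (P? : Dec P) → ρ ⊨ₙ φ ⇔ Q → ρ ⊨ₙ provided P? φ ⇔ (P × Q)
        provided-sat (yes p) e = mk⇔ (λ s → p , to e s) (from e ∘ proj₂)
        provided-sat (no ¬p) e = mk⇔ (⊥-elim ∘ false-sat) (λ (p , _) → contradiction p ¬p)

        anyOf-sat : ∀ {k l} (xs : Vec (Fin n) k) {φ} {P : V G → Set} → ⟦ xs ⟧ ρ ≡ l →
                    (∀ x → ρ ⊨ₙ φ x ⇔ P (lookup ρ x)) → ρ ⊨ₙ anyOf xs φ ⇔ Any P l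
        anyOf-sat []       refl e = mk⇔ (⊥-elim ∘ false-sat) (λ ())
        anyOf-sat (x ∷ xs) refl e = mk⇔
          (λ { (inj₁ q) → here (to (e x) q) ; (inj₂ q) → there (to (anyOf-sat xs refl e) q) })
          (λ { (here p) → inj₁ (from (e x) p) ; (there p) → inj₂ (from (anyOf-sat xs refl e) p) })

        allOf-sat : ∀ {k l} (xs : Vec (Fin n) k) {φ} {P : V G → Set} → ⟦ xs ⟧ ρ ≡ l →
                    (∀ x → ρ ⊨ₙ φ x ⇔ P (lookup ρ x)) → ρ ⊨ₙ allOf xs φ ⇔ All P l
        allOf-sat []       refl e = mk⇔ (λ _ → []) (λ _ → false-sat)
        allOf-sat (x ∷ xs) refl e = mk⇔
          (λ (q , qs) → to (e x) q ∷ to (allOf-sat xs refl e) qs)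
          (λ { (p ∷ ps) → from (e x) p , from (allOf-sat xs refl e) ps })

      all-⇔ : ∀ {P : V G → Set} {Q : V G → Set₁} → (∀ x → Q x ⇔ P x) → (∀ x → Q x) ⇔ (∀ x → P x)
      all-⇔ e = mk⇔ (λ q x → to (e x) (q x)) (λ p x → from (e x) (p x))

      ⟦↑⟧-≡ : ∀ {k n l} (p : Vec (Fin n) k) {ρ : Vec (V G) n} {x} → ⟦ p ⟧ ρ ≡ l → ⟦ ↑ p ⟧ (x ∷ ρ) ≡ l
      ⟦↑⟧-≡ p eq = trans (⟦↑⟧ p) eq

      -- The path of vertices is a variable `l` with an equation, so that it stays the same list
      -- when quantifiers extend the valuation and shift the indices.
      inU-sat  : ∀ {k n l} (p : Vec (Fin n) k) v {ρ} → ⟦ p ⟧ ρ ≡ l → ρ ⊨ₙ inU p v ⇔ InU G B l (lookup ρ v)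
      walk-sat : ∀ {k n l} (p : Vec (Fin n) k) m u v {ρ} → ⟦ p ⟧ ρ ≡ l →
                 ρ ⊨ₙ walk p m u v ⇔ Walk (Step G B l) m (lookup ρ u) (lookup ρ v)

      inU-sat []      v refl = true-sat
      inU-sat (x ∷ p) v refl = and-⇔ (inU-sat p v refl) (and-⇔ (not-⇔ lift-⇔) (walk-sat p B x v refl))

      walk-sat p zero    u v eq = lift-⇔
      walk-sat p (suc m) u v eq = or-⇔ lift-⇔ (ex-⇔ λ w → mk⇔
        (λ ((lift e , s) , ws) → (e , to (inU-sat (↑ p) zero (⟦↑⟧-≡ p eq)) s) ,
                                 to (walk-sat (↑ p) m zero (suc v) (⟦↑⟧-≡ p eq)) ws)
        (λ ((e , s) , ws) → (lift e , from (inU-sat (↑ p) zero (⟦↑⟧-≡ p eq)) s) ,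
                            from (walk-sat (↑ p) m zero (suc v) (⟦↑⟧-≡ p eq)) ws))

      adjacent-sat : ∀ D {k n l} (p : Vec (Fin n) k) x c {ρ} → ⟦ p ⟧ ρ ≡ l →
                     ρ ⊨ₙ adjacent D p x c ⇔ adjacency G B D l (lookup ρ x) ≡ c
      adjacent-sat zero    p  x []          eq   = mk⇔ (λ _ → refl) (λ _ → false-sat)
      adjacent-sat (suc D) [] x (true ∷ c)  refl = mk⇔ (⊥-elim ∘ false-sat) (λ ())
      adjacent-sat (suc D) [] x (false ∷ c) refl = mk⇔
        (λ s → cong (false ∷_) (to (adjacent-sat D [] x c refl) s))
        (λ e → from (adjacent-sat D [] x c refl) (cong Vec.tail e))
      adjacent-sat (suc D) (y ∷ p) x (true ∷ c) {ρ} refl = mk⇔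
        (λ (lift e , s) → cong₂ _∷_ (⌊⌋-true e) (to (adjacent-sat D p x c refl) s))
        (λ e → lift (true-⌊⌋ (cong Vec.head e)) , from (adjacent-sat D p x c refl) (cong Vec.tail e))
        where
        ⌊⌋-true : ∀ {P : Set} → P → ⌊ em {P} ⌋ ≡ true
        ⌊⌋-true {P} p with em {P}
        ... | yes _ = refl
        ... | no ¬p = contradiction p ¬p

        true-⌊⌋ : ∀ {P : Set} → ⌊ em {P} ⌋ ≡ true → P
        true-⌊⌋ {P} e with em {P}
        ... | yes p = p
      adjacent-sat (suc D) (y ∷ p) x (false ∷ c) {ρ} refl = mk⇔
        (λ (¬e , s) → cong₂ _∷_ (⌊⌋-false (¬e ∘ lift)) (to (adjacent-sat D p x c refl) s))
        (λ e → false-⌊⌋ (cong Vec.head e) ∘ lower , from (adjacent-sat D p x c refl) (cong Vec.tail e))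
        where
        ⌊⌋-false : ∀ {P : Set} → ¬ P → ⌊ em {P} ⌋ ≡ false
        ⌊⌋-false {P} ¬p with em {P}
        ... | yes p = contradiction p ¬p
        ... | no _  = refl

        false-⌊⌋ : ∀ {P : Set} → ⌊ em {P} ⌋ ≡ false → ¬ P
        false-⌊⌋ {P} e with em {P}
        ... | no ¬p = ¬p

      module _ (D t : ℕ) where

        hasType-sat : ∀ d {k n l} (p : Vec (Fin n) k) τ {ρ} → ⟦ p ⟧ ρ ≡ l →
                      ρ ⊨ₙ hasType D t d p τ ⇔ HasType D t G B d l τ
        isRoot-sat  : ∀ d {k n l} (p : Vec (Fin n) k) a x {ρ} → ⟦ p ⟧ ρ ≡ l →
                      ρ ⊨ₙ isRoot D t d p a x ⇔ IsRoot D t G B d l a (lookup ρ x)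
        roots-sat   : ∀ d {k m n l ls} (p : Vec (Fin n) k) as w (xs : Vec (Fin n) m) {ρ} →
                      ⟦ p ⟧ ρ ≡ l → ⟦ xs ⟧ ρ ≡ ls →
                      ρ ⊨ₙ roots D t d p as w xs ⇔ Roots D t G B d l as w ls

        hasType-sat zero    p τ eq = all-⇔ λ x → not-⇔ (inU-sat (↑ p) zero (⟦↑⟧-≡ p eq))
        hasType-sat (suc d) p τ {ρ} eq = disjunction-sat
          (λ w → provided-sat (em {wordType D t d w ≡ τ}) (roots-sat d p (frequent D t d w) w [] eq refl))
          (saturatedWords D t d)

        isRoot-sat d p (c , τ) x refl =
          and-⇔ (inU-sat p x refl) (and-⇔ (adjacent-sat D p x c refl) (hasType-sat d (x ∷ p) τ refl))

        roots-sat d p as [] xs eq eqs = all-⇔ λ y → guard-⇔ (inU-sat (↑ p) zero (⟦↑⟧-≡ p eq))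
          (or-⇔ (anyOf-sat (↑ xs) (⟦↑⟧-≡ xs eqs) (λ x → walk-sat (↑ p) B zero x (⟦↑⟧-≡ p eq)))
                (ex-⇔ λ x → and-⇔ (walk-sat (↑ (↑ p)) B (suc zero) zero (⟦↑⟧-≡ (↑ p) (⟦↑⟧-≡ p eq)))
                  (disjunction-sat (λ a → isRoot-sat d (↑ (↑ p)) a zero (⟦↑⟧-≡ (↑ p) (⟦↑⟧-≡ p eq))) as)))
        roots-sat d p as (a ∷ w) xs eq eqs = ex-⇔ λ x →
          and-⇔ (isRoot-sat d (↑ p) a zero (⟦↑⟧-≡ p eq))
            (and-⇔ (allOf-sat (↑ xs) (⟦↑⟧-≡ xs eqs) (λ x′ → not-⇔ (walk-sat (↑ p) B zero x′ (⟦↑⟧-≡ p eq))))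
                   (roots-sat d (↑ p) as w (zero ∷ ↑ xs) (⟦↑⟧-≡ p eq) (cong (x ∷_) (⟦↑⟧-≡ xs eqs))))

-- Tree depth: short walks, elimination forests, and depth-first search.

module TreeDepth (em : ∀ {P : Set} → Dec P) (ext : Extensionality 0ℓ 0ℓ) where

  open import Data.Irrelevant using () renaming ([_] to irr)
  open import Data.Refinement using (Refinement; value; proof; _,_)
  open Families em
  open Forests em
  open Elimination em ext
  open _⊑_

  -- Membership is decided by `em`; the irrelevant proof only refutes the negative answer.
  ∈-value : ∀ {A : Set} {P : A → Set} (a : Refinement A P) → P (value a)
  ∈-value {P = P} (a , irr p) with em {P a}
  ... | yes q = q
  ... | no ¬q = ⊥-elim-irr (¬q p)

  value-injective : ∀ {A : Set} {P : A → Set} {a b : Refinement A P} → value a ≡ value b → a ≡ b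
  value-injective {a = _ , irr _} {_ , irr _} refl = refl

  -- Short walks

  -- A walk through the deleted vertex consists of a part before it, an edge to it, an edge from it
  -- and a part after it.
  walkBound : ℕ → ℕ
  walkBound zero    = 0
  walkBound (suc d) = (walkBound d + 1) + (1 + walkBound d)

  Walk-map : ∀ {A B : Set} {R : A → A → Set} {S : B → B → Set} (f : A → B) → (∀ {x y} → R x y → S (f x) (f y)) →
             ∀ n {u v} → Walk R n u v → Walk S n (f u) (f v)
  Walk-map f h zero    refl                = refl
  Walk-map f h (suc n) (inj₁ refl)         = inj₁ refl
  Walk-map f h (suc n) (inj₂ (w , r , ws)) = inj₂ (f w , h r , Walk-map f h n ws)

  module _ (H : Graph) (h : V H) where

    Avoiding : V H → V H → Set
    Avoiding a b = E H a b × a ≢ h × b ≢ h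

    ToPoint FromPoint : V H → Set
    ToPoint   u = u ≡ h ⊎ ∃[ a ] Star Avoiding u a × E H a h
    FromPoint v = v ≡ h ⊎ ∃[ b ] E H h b × Star Avoiding b v

    -- The walk is cut at its first and its last visit to `h`; whatever lies between is dropped.
    split-at : ∀ {u v} → Star (E H) u v → Star Avoiding u v ⊎ ToPoint u × FromPoint v
    split-at ε = inj₁ ε
    split-at {u} {v} (_◅_ {j = w} e s) with em {u ≡ h} | em {w ≡ h} | split-at s
    ... | no u≢  | no w≢    | inj₁ s′                 = inj₁ ((e , u≢ , w≢) ◅ s′)
    ... | yes u≡ | _        | inj₁ s′                 = inj₂ (inj₁ u≡ , inj₂ (w , subst (λ z → E H z w) u≡ e , s′))
    ... | no u≢  | yes refl | inj₁ ε                  = inj₂ (inj₂ (u , ε , e) , inj₁ refl)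
    ... | no u≢  | yes refl | inj₁ ((_ , h≢ , _) ◅ _) = contradiction refl h≢
    ... | yes u≡ | _        | inj₂ (_ , from)         = inj₂ (inj₁ u≡ , from)
    ... | no u≢  | yes refl | inj₂ (_ , from)         = inj₂ (inj₂ (u , ε , e) , from)
    ... | no u≢  | no w≢    | inj₂ (inj₁ w≡ , from)   = contradiction w≡ w≢
    ... | no u≢  | no w≢    | inj₂ (inj₂ (a , s′ , e′) , from) = inj₂ (inj₂ (a , (e , u≢ , w≢) ◅ s′ , e′) , from)

    avoiding⇒Star : ∀ {u v} (u≢ : u ≢ h) → Star Avoiding u v → Σ[ v≢ ∈ v ≢ h ] Star (E (H - h)) (u , irr u≢) (v , irr v≢)
    avoiding⇒Star u≢ ε                     = u≢ , ε
    avoiding⇒Star u≢ ((e , _ , w≢) ◅ s) with avoiding⇒Star w≢ s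
    ... | v≢ , s′ = v≢ , e ◅ s′

    avoiding-short : ∀ n → (∀ u v → Star (E (H - h)) u v → Walk (E (H - h)) n u v) →
                     ∀ {u v} → Star Avoiding u v → Walk (E H) n u v
    avoiding-short n short ε                       = Walk-refl n
    avoiding-short n short s@((_ , u≢ , _) ◅ _) =
      Walk-map value id n (short _ _ (proj₂ (avoiding⇒Star u≢ s)))

  component-Star : ∀ (H : Graph) {c u v} (s : Star (E H) c u) (s′ : Star (E H) u v) →
                   Star (E (component H c)) (u , irr s) (v , irr (s ◅◅ s′))
  component-Star H s ε        = ε
  component-Star H s (e ◅ s′) = e ◅ subst (Star (E (component H _)) _) (value-injective refl)
                                      (component-Star H (s ◅◅ e ◅ ε) s′)

  -⊑- : ∀ {H G} (s : H ⊑ G) h → (H - h) ⊑ (G - embed s h)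
  -⊑- s h = record
    { embed     = λ { (u , irr u≢) → embed s u , irr (λ eq → u≢ (injective s eq)) }
    ; injective = λ eq → value-injective (injective s (cong value eq))
    ; edge      = edge s
    }

  -- `Short` needs short walks in every `G [ InU G B p ]`, whereas only `td G` is bounded; so the
  -- induction on the derivation carries an arbitrary subgraph `H`. If `H` misses the deleted
  -- vertex, it embeds in `G - x`; otherwise its walks are split there.
  Star⇒Walk : ∀ {G H d} → td G ≤ d → H ⊑ G → ∀ u v → Star (E H) u v → Walk (E H) (walkBound d) u v
  Star⇒Walk (one (x , all≡x)) s u v _
    with refl ← injective s (trans (all≡x (embed s u)) (sym (all≡x (embed s v)))) = Walk-refl _
  Star⇒Walk {H = H} (conn {d = d} _ _ x t) s u v w with em {∃[ h ] embed s h ≡ x}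
  ... | no ¬h = Walk-mono (ℕ.≤-trans (ℕ.m≤n+m _ (walkBound d + 1)) (ℕ.+-monoʳ-≤ (walkBound d + 1) (ℕ.n≤1+n _)))
    (Star⇒Walk t s′ u v w)
    where
    s′ : H ⊑ _
    s′ = record
      { embed     = λ u → embed s u , irr (λ eq → ¬h (u , eq))
      ; injective = λ eq → injective s (cong value eq)
      ; edge      = edge s
      }
  ... | yes (h , refl) with split-at H h w
  ...   | inj₁ s′ = Walk-mono (ℕ.≤-trans (ℕ.m≤n+m _ (walkBound d + 1)) (ℕ.+-monoʳ-≤ (walkBound d + 1) (ℕ.n≤1+n _)))
                      (avoiding-short H h _ (Star⇒Walk t (-⊑- s h)) s′)
  ...   | inj₂ (to , from) = Walk-++ (walkBound d + 1) (to-walk to) (from-walk from)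
    where
    to-walk : ToPoint H h u → Walk (E H) (walkBound d + 1) u h
    to-walk (inj₁ refl)         = Walk-refl (walkBound d + 1)
    to-walk (inj₂ (a , s′ , e)) =
      Walk-++ (walkBound d) (avoiding-short H h _ (Star⇒Walk t (-⊑- s h)) s′) (inj₂ (h , e , refl))

    from-walk : FromPoint H h v → Walk (E H) (1 + walkBound d) h v
    from-walk (inj₁ refl)         = Walk-refl (1 + walkBound d)
    from-walk (inj₂ (b , e , s′)) = inj₂ (b , e , avoiding-short H h _ (Star⇒Walk t (-⊑- s h)) s′)
  Star⇒Walk {G} {H} {d} (comps _ _ f) s u v w =
    Walk-map value id (walkBound d) (Star⇒Walk (f (embed s u)) s′ (u , irr ε) (v , irr (ε ◅◅ w)) (component-Star H ε w))
    where
    s′ : component H u ⊑ component G (embed s u)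
    s′ = record
      { embed     = λ { (a , irr c) → embed s a , irr (gmap (embed s) (edge s) c) }
      ; injective = λ eq → value-injective (injective s (cong value eq))
      ; edge      = edge s
      }

  []-⊑ : ∀ G P → (G [ P ]) ⊑ G
  []-⊑ G P = record { embed = value ; injective = value-injective ; edge = id }

  td⇒Short : ∀ {G d} → td G ≤ d → Short G (walkBound d)
  td⇒Short {G} {d} t p {n} u∈ w = Walk-map value (λ {_} {b} e → e , ∈-value b) B
    (Star⇒Walk t ([]-⊑ G (InU G B p)) _ _ (proj₂ (inside n u∈ w)))
    where
    B = walkBound d
    inside : ∀ n {u v} (u∈ : InU G B p u) → Walk (Step G B p) n u v →
             Σ[ v∈ ∈ InU G B p v ] Star (E (G [ InU G B p ])) (u , irr u∈) (v , irr v∈)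
    inside zero    u∈ refl                     = u∈ , ε
    inside (suc n) u∈ (inj₁ refl)              = u∈ , ε
    inside (suc n) u∈ (inj₂ (_ , (e , x∈) , w)) with inside n x∈ w
    ... | v∈ , s = v∈ , e ◅ s

  -- Elimination forests

  module _ (G : Graph) (B : ℕ) (short : Short G B) where

    RootFor : List (V G) → ℕ → V G → Set₁
    RootFor p zero    v = Level.Lift _ ⊥
    RootFor p (suc d) v = Σ[ x ∈ V G ] (InU G B p x × Conn G B p v x × Σ[ F ∈ Forest d ] Elim G B (x ∷ p) F)

    assembleElim : ∀ p d → (∀ {v} → InU G B p v → RootFor p d v) → Σ[ F ∈ Forest d ] Elim G B p F
    assembleElim p zero    R = empty , λ v v∈ → Level.lower (R v∈)
    assembleElim p (suc d) R =
      grow (Representatives.Rep G B short p) (λ i → proj₁ (tree i)) ,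
      assemble G B short (λ v∈ → proj₁ (R v∈)) (λ v∈ → proj₁ (proj₂ (R v∈))) (λ v∈ → proj₁ (proj₂ (proj₂ (R v∈))))
        (λ i → proj₂ (tree i))
      where
      tree : ∀ i → Σ[ F ∈ Forest d ] Elim G B (proj₁ (R (Representatives.Rep∈ G B short p i)) ∷ p) F
      tree i = proj₂ (proj₂ (proj₂ (R (Representatives.Rep∈ G B short p i))))

    -- ι identifies H with a union of components of InU p.
    record Part (H : Graph) (p : List (V G)) : Set where
      field
        ι        : V H → V G
        ι-inj    : ∀ {a b} → ι a ≡ ι b → a ≡ b
        ι-edge   : ∀ {a b} → E H a b → E G (ι a) (ι b)
        range    : ∀ a → InU G B p (ι a)
        closed   : ∀ a {v} → InU G B p v → E G (ι a) v → ∃[ b ] ι b ≡ v × E H a b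

      Star⇒Conn : ∀ {a b} → Star (E H) a b → Conn G B p (ι a) (ι b)
      Star⇒Conn ε       = Conn-refl G B short p
      Star⇒Conn (e ◅ s) = Conn-trans G B short p (range _) (edge⇒Conn G B short p (range _) (range _) (ι-edge e)) (Star⇒Conn s)

      Conn⇒Star : ∀ n {a v} → Walk (Step G B p) n (ι a) v → ∃[ b ] ι b ≡ v × Star (E H) a b
      Conn⇒Star zero    refl        = _ , refl , ε
      Conn⇒Star (suc n) (inj₁ refl) = _ , refl , ε
      Conn⇒Star (suc n) {a} (inj₂ (w , (e , w∈) , ws)) with closed a w∈ e
      ... | b , refl , e′ with Conn⇒Star n ws
      ...   | c , eq , s = c , eq , e′ ◅ s
    open Part

    -- Follows the derivation of `td H ≤ d`: `conn` makes `x` the root and spends one level, while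
    -- `comps` spends none and merely shrinks the part to the component of `a`.
    rootFor : ∀ {H d} → td H ≤ d → ∀ p (P : Part H p) a → RootFor p d (ι P a)
    rootFor {H} (one {d = d} (x , all≡x)) p P a =
      ι P x , range P x , subst (λ z → Conn G B p (ι P z) (ι P x)) (sym (all≡x a)) (Conn-refl G B short p) ,
      assembleElim (ι P x ∷ p) d λ (v∈ , v≢ , c) → ⊥-elim (outside v≢ (Conn⇒Star P B c))
      where
      outside : ∀ {v} → v ≢ ι P x → ¬ (∃[ b ] ι P b ≡ v × Star (E H) x b)
      outside v≢ (b , refl , _) = v≢ (cong (ι P) (all≡x b))
    rootFor {H} (conn {d = d} _ connected x t) p P a =
      ι P x , range P x , Star⇒Conn P (connected a x) ,
      assembleElim (ι P x ∷ p) d below-root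
      where
      P′ : Part (H - x) (ι P x ∷ p)
      P′ = record
        { ι      = ι P ∘ value
        ; ι-inj  = λ eq → value-injective (ι-inj P eq)
        ; ι-edge = ι-edge P
        ; range  = λ b → range P (value b) , (λ eq → ∈-value b (ι-inj P eq)) , Star⇒Conn P (connected x (value b))
        ; closed = λ b (v∈ , v≢ , _) e → let (c , eq , e′) = closed P (value b) v∈ e in
                     (c , irr (λ c≡x → v≢ (trans (sym eq) (cong (ι P) c≡x)))) , eq , e′
        }

      below-root : ∀ {v} → InU G B (ι P x ∷ p) v → RootFor (ι P x ∷ p) d v
      below-root (v∈ , v≢ , c) with Conn⇒Star P B c
      ... | b , refl , _ = rootFor t (ι P x ∷ p) P′ (b , irr (λ b≡x → v≢ (cong (ι P) b≡x)))
    rootFor {H} (comps _ _ f) p P a = rootFor (f a) p P′ (a , irr ε)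
      where
      P′ : Part (component H a) p
      P′ = record
        { ι      = ι P ∘ value
        ; ι-inj  = λ eq → value-injective (ι-inj P eq)
        ; ι-edge = ι-edge P
        ; range  = λ b → range P (value b)
        ; closed = λ b v∈ e → let (c , eq , e′) = closed P (value b) v∈ e in
                     (c , irr (∈-value b ◅◅ e′ ◅ ε)) , eq , e′
        }

  td⇒Elim : ∀ {G d} → td G ≤ d → Σ[ F ∈ Forest d ] Elim G (walkBound d) [] F
  td⇒Elim {G} {d} t = assembleElim G B (td⇒Short t) [] d λ {v} _ → rootFor G B (td⇒Short t) t [] whole v
    where
    B = walkBound d
    whole : Part G B (td⇒Short t) G []
    whole = record { ι = id ; ι-inj = id ; ι-edge = id ; range = λ _ → tt ; closed = λ a {v} _ e → v , refl , e }

  -- Graphs without long paths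

  IsPath : (G : Graph) → List (V G) → Set
  IsPath G xs = Linked (E G) xs × Unique xs

  -- Here `n` counts edges: the initial vertex `v` is not among `xs`.
  PathFrom : (G : Graph) → V G → ℕ → Set
  PathFrom G v n = ∃[ xs ] IsPath G (v ∷ xs) × length xs ≡ n

  PathFrom-value : ∀ {G P} {v : V (G [ P ])} {n} → PathFrom (G [ P ]) v n →
                   ∃[ xs ] IsPath G (value v ∷ xs) × length xs ≡ n × All P xs
  PathFrom-value {v = v} (xs , (l , u) , refl) =
    map value xs , (Linked.map⁺ l , Unique.map⁺ value-injective u) , length-map value xs ,
    All.map⁺ (All.tabulate λ {x} _ → ∈-value x)

  -- A depth-first search: the component of u is eliminated starting from u, and
  -- every remaining component contains a neighbour of u.
  connected-td : ∀ k H u → Connected H → ¬ PathFrom H u k → td H ≤ k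
  no-path⇒td : ∀ k H → (∀ v → ∃[ u ] Star (E H) v u × ¬ PathFrom H u k) → td H ≤ k

  -- The vertex `u` alone is a path with no edge.
  connected-td zero    H u con ¬p = contradiction ([] , ([-] , [] ∷ []) , refl) ¬p
  connected-td (suc k) H u con ¬p with em {OneVertex H} | em {∃[ y ] u ≢ y}
  ... | yes o | _           = one o
  ... | no ¬o | no ¬y       = contradiction (u , same) ¬o
    where
    same : ∀ y → y ≡ u
    same y with em {y ≡ u}
    ... | yes eq = eq
    ... | no neq = contradiction (y , neq ∘ sym) ¬y
  ... | no ¬o | yes (y , u≢y) = conn (u , y , u≢y) con u (no-path⇒td k (H - u) neighbour)
    where
    towards : ∀ {v} (v≢ : v ≢ u) → Star (E H) v u → ∃[ w ] Star (E (H - u)) (v , irr v≢) w × E H (value w) u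
    towards v≢ ε = contradiction refl v≢
    towards v≢ (_◅_ {j = w} e s) with em {w ≡ u}
    ... | yes refl = _ , ε , e
    ... | no w≢ with towards w≢ s
    ...   | z , s′ , e′ = z , e ◅ s′ , e′

    neighbour : ∀ v → ∃[ w ] Star (E (H - u)) v w × ¬ PathFrom (H - u) w k
    neighbour v with towards (∈-value v) (con (value v) u)
    ... | w , s , e = w , s , λ q → case-path (PathFrom-value {H} {_≢ u} q)
      where
      case-path : ¬ (∃[ xs ] IsPath H (value w ∷ xs) × length xs ≡ k × All (_≢ u) xs)
      -- A path with `k` edges from `w` that avoids `u` becomes one with `suc k` edges when `u` is
      -- put in front.
      case-path (xs , (l , uq) , refl , av) =
        ¬p (value w ∷ xs , (E-sym H e ∷ l , ((∈-value w ∘ sym) ∷ All.map (_∘ sym) av) ∷ uq) , refl)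

  no-path⇒td k H ends with em {OneVertex H ⊎ ManyVertices H × Connected H}
  no-path⇒td k H ends | yes (inj₁ (x , all≡x)) with ends x
  ... | u , _ , ¬p = connected-td k H u (λ a b → subst (Star (E H) a) (trans (all≡x a) (sym (all≡x b))) ε) ¬p
  no-path⇒td k H ends | yes (inj₂ ((x , _) , con)) with ends x
  ... | u , _ , ¬p = connected-td k H u con ¬p
  no-path⇒td k H ends | no ¬c = comps (¬c ∘ inj₁) (¬c ∘ inj₂) λ v → part v (ends v)
    where
    part : ∀ v → ∃[ u ] Star (E H) v u × ¬ PathFrom H u k → td (component H v) ≤ k
    part v (u , s , ¬p) = connected-td k (component H v) (u , irr s) con
      (λ q → let (xs , path , l , _) = PathFrom-value {H} {Star (E H) v} q in ¬p (xs , path , l))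
      where
      reverse : ∀ {a b} → Star (E H) a b → Star (E H) b a
      reverse ε       = ε
      reverse (e ◅ s) = reverse s ◅◅ E-sym H e ◅ ε

      con : Connected (component H v)
      con a b = subst (Star (E (component H v)) a) (value-injective refl)
        (component-Star H (∈-value a) (reverse (∈-value a) ◅◅ ∈-value b))

-- Paths: long ones are alike for FO, while MSO knows the parity of their length.

module Paths where

  open Semantics Arbitrary

  path : ℕ → Graph
  path n = record
    { V      = Fin n
    ; E      = λ i j → toℕ j ≡ suc (toℕ i) ⊎ toℕ i ≡ suc (toℕ j)
    ; sym    = swap
    ; irrefl = λ { refl (inj₁ e) → ℕ.1+n≢n (sym e) ; refl (inj₂ e) → ℕ.1+n≢n (sym e) }
    }

  path-⊑ : ∀ n → path n ⊑ path (suc n)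
  path-⊑ n = record
    { embed     = inject₁
    ; injective = Fin.inject₁-injective
    ; edge      = λ {i} {j} e → subst (λ a → toℕ (inject₁ j) ≡ suc a ⊎ a ≡ suc (toℕ (inject₁ j))) (sym (Fin.toℕ-inject₁ i))
                    (subst (λ b → b ≡ suc (toℕ i) ⊎ toℕ i ≡ suc b) (sym (Fin.toℕ-inject₁ j)) e)
    }

  list⇒path : ∀ G xs → Linked (E G) xs → Unique xs → path (length xs) ⊑ G
  list⇒path G xs l u = record
    { embed     = List.lookup xs
    ; injective = λ {i} {j} → lookup-injective xs u i j
    ; edge      = λ { {i} {j} (inj₁ e) → next xs l i j e
                    ; {i} {j} (inj₂ e) → Graph.sym G (next xs l j i e) }
    }
    where
    lookup-injective : ∀ {A : Set} (xs : List A) → Unique xs → ∀ i j → List.lookup xs i ≡ List.lookup xs j → i ≡ j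
    lookup-injective (x ∷ xs) (a ∷ u) zero    zero    eq = refl
    lookup-injective (x ∷ xs) (a ∷ u) zero    (suc j) eq = contradiction eq (All.lookup a (∈-lookup j))
    lookup-injective (x ∷ xs) (a ∷ u) (suc i) zero    eq = contradiction (sym eq) (All.lookup a (∈-lookup i))
    lookup-injective (x ∷ xs) (a ∷ u) (suc i) (suc j) eq = cong suc (lookup-injective xs u i j eq)

    next : ∀ xs → Linked (E G) xs → ∀ i j → toℕ j ≡ suc (toℕ i) → E G (List.lookup xs i) (List.lookup xs j)
    next (x ∷ y ∷ xs) (e ∷ l) zero    (suc zero) _  = e
    next (x ∷ y ∷ xs) (e ∷ l) (suc i) (suc j)    eq = next (y ∷ xs) l i j (ℕ.suc-injective eq)
    next (x ∷ [])     [-]     zero    zero       ()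

  -- First-order equivalence of long paths

  -- The distances that k further moves cannot tell apart.
  _≈[_]_ : ℕ → ℕ → ℕ → Set
  g ≈[ k ] g′ = g ≡ g′ ⊎ (2 ^ k ≤ g × 2 ^ k ≤ g′)

  ≈-sym : ∀ k {g g′} → g ≈[ k ] g′ → g′ ≈[ k ] g
  ≈-sym k (inj₁ eq)      = inj₁ (sym eq)
  ≈-sym k (inj₂ (l , m)) = inj₂ (m , l)

  ≈-+ : ∀ k {g g′ h h′} → g ≈[ k ] g′ → h ≈[ k ] h′ → (h + g) ≈[ k ] (h′ + g′)
  ≈-+ k (inj₁ refl)      (inj₁ refl)    = inj₁ refl
  ≈-+ k {h = h} {h′} (inj₂ (l , m)) _ = inj₂ (ℕ.≤-trans l (ℕ.m≤n+m _ h) , ℕ.≤-trans m (ℕ.m≤n+m _ h′))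
  ≈-+ k {h = h} {h′} _ (inj₂ (l , m)) = inj₂ (ℕ.≤-trans l (ℕ.m≤m+n h _) , ℕ.≤-trans m (ℕ.m≤m+n h′ _))

  ≈-weaken : ∀ k {g g′} → g ≈[ suc k ] g′ → g ≈[ k ] g′
  ≈-weaken k (inj₁ eq)      = inj₁ eq
  ≈-weaken k (inj₂ (l , m)) = inj₂ (ℕ.≤-trans (ℕ.m≤m+n (2 ^ k) _) l , ℕ.≤-trans (ℕ.m≤m+n (2 ^ k) _) m)

  -- A gap of at least `2 ^ suc k` has a part of at least `2 ^ k` on one side. A part shorter than
  -- that is copied exactly; if both are long, the other gap is cut at `2 ^ k`.
  ≈-split : ∀ k i j {g′} → (j + i) ≈[ suc k ] g′ → ∃[ i′ ] ∃[ j′ ] g′ ≡ j′ + i′ × i ≈[ k ] i′ × j ≈[ k ] j′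
  ≈-split k i j (inj₁ refl) = i , j , refl , inj₁ refl , inj₁ refl
  ≈-split k i j {g′} (inj₂ (l , m)) = cut (2 ^ k ≤? i) (2 ^ k ≤? j)
    where
    double : ∀ {x} → 2 ^ suc k ≤ x → 2 ^ k + 2 ^ k ≤ x
    double {x} = subst (_≤ x) (cong (2 ^ k +_) (ℕ.+-identityʳ (2 ^ k)))

    remains : ∀ {a x} → a ≤ 2 ^ k → 2 ^ suc k ≤ x → 2 ^ k ≤ x ∸ a
    remains {a} {x} a≤ l = ℕ.m+n≤o⇒m≤o∸n (2 ^ k) (ℕ.≤-trans (ℕ.+-monoʳ-≤ (2 ^ k) a≤) (double l))

    inside : ∀ {a} → a ≤ 2 ^ k → a ≤ g′
    inside a≤ = ℕ.≤-trans a≤ (ℕ.≤-trans (ℕ.m≤m+n (2 ^ k) _) m)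

    cut : _ → _ → _
    cut (yes i≥) (yes j≥) = 2 ^ k , g′ ∸ 2 ^ k , sym (ℕ.m∸n+n≡m (inside ℕ.≤-refl)) ,
                            inj₂ (i≥ , ℕ.≤-refl) , inj₂ (j≥ , remains ℕ.≤-refl m)
    cut (no i≱) _ = i , g′ ∸ i , sym (ℕ.m∸n+n≡m (inside i≤)) , inj₁ refl ,
                    inj₂ (subst (2 ^ k ≤_) (ℕ.m+n∸n≡m j i) (remains i≤ l) , remains i≤ m)
      where i≤ = ℕ.<⇒≤ (ℕ.≰⇒> i≱)
    cut _ (no j≱) = g′ ∸ j , j , sym (ℕ.m+[n∸m]≡n (inside j≤)) ,
                    inj₂ (subst (2 ^ k ≤_) (ℕ.m+n∸m≡n j i) (remains j≤ l) , remains j≤ m) , inj₁ refl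
      where j≤ = ℕ.<⇒≤ (ℕ.≰⇒> j≱)

  -- Two increasing sequences of positions, from a to b and from a′ to b′, with
  -- indistinguishable gaps.
  data Gaps (k : ℕ) (a a′ b b′ : ℕ) : Set where
    end  : a ≡ b → a′ ≡ b′ → Gaps k a a′ b b′
    step : ∀ {g g′ c c′} → g ≈[ k ] g′ → c ≡ g + a → c′ ≡ g′ + a′ → Gaps k c c′ b b′ → Gaps k a a′ b b′

  data _,_On_ {k} (x x′ : ℕ) : ∀ {a a′ b b′} → Gaps k a a′ b b′ → Set where
    start : ∀ {b b′} {gs : Gaps k x x′ b b′} → x , x′ On gs
    later : ∀ {a a′ b b′ g g′ c c′ r} {eq : c ≡ g + a} {eq′ : c′ ≡ g′ + a′} {gs : Gaps k c c′ b b′} →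
            x , x′ On gs → x , x′ On step {a = a} {a′} {g = g} {g′} r eq eq′ gs

  module _ {k : ℕ} where

    On-distance : ∀ {x x′ a a′ b b′} {gs : Gaps k a a′ b b′} → x , x′ On gs →
                  ∃[ g ] ∃[ g′ ] g ≈[ k ] g′ × x ≡ g + a × x′ ≡ g′ + a′
    On-distance start = 0 , 0 , inj₁ refl , refl , refl
    On-distance (later {a = a} {a′ = a′} {g = g} {g′ = g′} {r = r} {eq = eq} {eq′ = eq′} o) with On-distance o
    ... | h , h′ , r′ , p , p′ = h + g , h′ + g′ , ≈-+ k r r′ ,
      trans p (trans (cong (h +_) eq) (sym (ℕ.+-assoc h g a))) ,
      trans p′ (trans (cong (h′ +_) eq′) (sym (ℕ.+-assoc h′ g′ a′)))

    Apart : ℕ → ℕ → ℕ → ℕ → Set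
    Apart x x′ y y′ = ∃[ g ] ∃[ g′ ] g ≈[ k ] g′ × y ≡ g + x × y′ ≡ g′ + x′

    On-compare : ∀ {x x′ y y′ a a′ b b′} {gs : Gaps k a a′ b b′} → x , x′ On gs → y , y′ On gs →
                 Apart x x′ y y′ ⊎ Apart y y′ x x′
    On-compare start     o         = inj₁ (On-distance o)
    On-compare o         start     = inj₂ (On-distance o)
    On-compare (later o) (later q) = On-compare o q

    Gaps-sym : ∀ {a a′ b b′} → Gaps k a a′ b b′ → Gaps k a′ a b′ b
    Gaps-sym (end eq eq′)         = end eq′ eq
    Gaps-sym (step r eq eq′ gs) = step (≈-sym k r) eq′ eq (Gaps-sym gs)

    On-sym : ∀ {x x′ a a′ b b′} {gs : Gaps k a a′ b b′} → x , x′ On gs → x′ , x On Gaps-sym gs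
    On-sym start     = start
    On-sym (later o) = later (On-sym o)

    Gaps-≤ : ∀ {a a′ b b′} → Gaps k a a′ b b′ → a ≤ b × a′ ≤ b′
    Gaps-≤ (end refl refl) = ℕ.≤-refl , ℕ.≤-refl
    Gaps-≤ (step {g} {g′} r refl refl gs) with Gaps-≤ gs
    ... | l , l′ = ℕ.m+n≤o⇒n≤o g l , ℕ.m+n≤o⇒n≤o g′ l′

  module _ {k : ℕ} where

    weaken : ∀ {a a′ b b′} → Gaps (suc k) a a′ b b′ → Gaps k a a′ b b′
    weaken (end eq eq′)        = end eq eq′
    weaken (step r eq eq′ gs) = step (≈-weaken k r) eq eq′ (weaken gs)

    On-weaken : ∀ {x x′ a a′ b b′} {gs : Gaps (suc k) a a′ b b′} → x , x′ On gs → x , x′ On weaken gs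
    On-weaken start     = start
    On-weaken (later o) = later (On-weaken o)

    On-refine : ∀ {a a′ b b′ c c′ d d′ g g′ h h′ i i′ y y′} {gs : Gaps (suc k) c c′ b b′}
      {r : g ≈[ suc k ] g′} {eq : c ≡ g + a} {eq′ : c′ ≡ g′ + a′}
      {ri : i ≈[ k ] i′} {e : d ≡ i + a} {e′ : d′ ≡ i′ + a′}
      {rj : h ≈[ k ] h′} {f : c ≡ h + d} {f′ : c′ ≡ h′ + d′} →
      y , y′ On step {a = a} {a′} {g = g} {g′} r eq eq′ gs →
      y , y′ On step {a = a} {a′} {g = i} {i′} ri e e′ (step {a = d} {d′} {g = h} {h′} rj f f′ (weaken gs))
    On-refine start     = start
    On-refine (later o) = later (later (On-weaken o))

    -- One move: the gap into which `x` falls is split on both sides, and every other gap merely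
    -- loses one level of precision.
    insert : ∀ {a a′ b b′} (gs : Gaps (suc k) a a′ b b′) x → a ≤ x → x ≤ b →
      ∃[ x′ ] x′ ≤ b′ × Σ[ hs ∈ Gaps k a a′ b b′ ] x , x′ On hs × (∀ {y y′} → y , y′ On gs → y , y′ On hs)
    insert (end refl refl) x a≤x x≤b with refl ← ℕ.≤-antisym a≤x x≤b = _ , ℕ.≤-refl , end refl refl , start , On-weaken
    insert {a} {a′} {b′ = b′} (step {g} {g′} r refl refl gs) x a≤x x≤b with x ≤? g + a
    ... | no x≰ with insert gs x (ℕ.<⇒≤ (ℕ.≰⇒> x≰)) x≤b
    ...   | x′ , x′≤ , hs , o , keep = x′ , x′≤ , step (≈-weaken k r) refl refl hs , later o ,
            λ { start → start ; (later p) → later (keep p) }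
    insert {a} {a′} {b′ = b′} (step {g} {g′} r refl refl gs) x a≤x x≤b | yes x≤
      with ≈-split k (x ∸ a) (g + a ∸ x) (subst (_≈[ suc k ] g′) (sym recompose) r)
      where
      recompose : g + a ∸ x + (x ∸ a) ≡ g
      recompose = trans (sym (ℕ.+-∸-assoc (g + a ∸ x) a≤x)) (trans (cong (_∸ a) (ℕ.m∸n+n≡m x≤)) (ℕ.m+n∸n≡m g a))
    ... | i′ , j′ , refl , ri , rj =
      i′ + a′ , ℕ.≤-trans (ℕ.m≤n+m (i′ + a′) j′) (ℕ.≤-trans (ℕ.≤-reflexive (sym (ℕ.+-assoc j′ i′ a′))) (proj₂ (Gaps-≤ gs))) ,
      step ri (sym (ℕ.m∸n+n≡m a≤x)) refl (step rj (sym (ℕ.m∸n+n≡m x≤)) (ℕ.+-assoc j′ i′ a′) (weaken gs)) ,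
      later start , On-refine

  -- Atoms have rank 1 rather than 0: with `2 ^ 1` the gaps 0 and 1 are still exact, as equality and
  -- adjacency require.
  rank : ∀ {n} → Formula (λ _ → ⊥) n [] → ℕ
  rank (i ≐ j)   = 1
  rank (i ~ j)   = 1
  rank (not φ)   = rank φ
  rank (φ and ψ) = rank φ ⊔ rank ψ
  rank (φ or ψ)  = rank φ ⊔ rank ψ
  rank (ex φ)    = suc (rank φ)
  rank (all φ)   = suc (rank φ)

  module _ {k : ℕ} (1≤k : 1 ≤ k) where

    private
      2≤2^k : 2 ≤ 2 ^ k
      2≤2^k = ℕ.^-monoʳ-≤ 2 1≤k

    ≈-small : ∀ {g g′} → g ≤ 1 → g ≈[ k ] g′ → g ≡ g′
    ≈-small g≤ (inj₁ eq)      = eq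
    ≈-small g≤ (inj₂ (l , _)) = contradiction (ℕ.≤-trans 2≤2^k (ℕ.≤-trans l g≤)) λ { (s≤s ()) }

    Apart-small : ∀ g {x x′ y y′} → g ≤ 1 → Apart {k} x x′ y y′ → y ≡ g + x → y′ ≡ g + x′
    Apart-small g {x} g≤ (h , h′ , r , refl , refl) eq with refl ← ℕ.+-cancelʳ-≡ x h g eq with refl ← ≈-small g≤ r = refl

    On-equal : ∀ {x x′ y y′ a a′ b b′} {gs : Gaps k a a′ b b′} → x , x′ On gs → y , y′ On gs → x ≡ y → x′ ≡ y′
    On-equal o q refl with On-compare o q
    ... | inj₁ ap = sym (Apart-small 0 z≤n ap refl)
    ... | inj₂ ap = Apart-small 0 z≤n ap refl

    On-suc : ∀ {x x′ y y′ a a′ b b′} {gs : Gaps k a a′ b b′} → x , x′ On gs → y , y′ On gs → y ≡ suc x → y′ ≡ suc x′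
    On-suc {x} o q refl with On-compare o q
    ... | inj₁ ap = Apart-small 1 ℕ.≤-refl ap refl
    ... | inj₂ (g , _ , _ , eq , _) = contradiction (ℕ.≤-trans (ℕ.m≤n+m (suc x) g) (ℕ.≤-reflexive (sym eq))) (ℕ.<⇒≱ ℕ.≤-refl)

  record Matching (k : ℕ) {N N′ n} (ρ : Vec (Fin (suc N)) n) (ρ′ : Vec (Fin (suc N′)) n) : Set where
    constructor _,_
    field
      gaps : Gaps k 0 0 N N′
      on   : ∀ j → toℕ (lookup ρ j) , toℕ (lookup ρ′ j) On gaps

  Matching-sym : ∀ k {N N′ n} {ρ : Vec (Fin (suc N)) n} {ρ′ : Vec (Fin (suc N′)) n} → Matching k ρ ρ′ → Matching k ρ′ ρ
  Matching-sym k (gs , on) = Gaps-sym gs , λ j → On-sym (on j)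

  extend : ∀ k {N N′ n} {ρ : Vec (Fin (suc N)) n} {ρ′ : Vec (Fin (suc N′)) n} → Matching (suc k) ρ ρ′ →
           ∀ x → ∃[ x′ ] Matching k (x ∷ ρ) (x′ ∷ ρ′)
  extend k (gs , on) x with insert gs (toℕ x) z≤n (Fin.toℕ≤pred[n] x)
  ... | x′ , x′≤ , hs , o , keep = fromℕ< (s≤s x′≤) , hs ,
    λ { zero    → subst (λ z → toℕ x , z On hs) (sym (Fin.toℕ-fromℕ< (s≤s x′≤))) o
      ; (suc j) → keep (on j) }

  path-transfer : ∀ {n} (φ : Formula (λ _ → ⊥) n []) k → rank φ ≤ k → ∀ {N N′ ρ ρ′} →
    Matching k {N} {N′} ρ ρ′ → Sat (path (suc N)) ρ [] φ → Sat (path (suc N′)) ρ′ [] φ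
  path-transfer (i ≐ j) k l (gs , on) (lift eq) = lift (Fin.toℕ-injective (On-equal l (on i) (on j) (cong toℕ eq)))
  path-transfer (i ~ j) k l (gs , on) (lift e)  = lift (Sum.map (On-suc l (on i) (on j)) (On-suc l (on j) (on i)) e)
  path-transfer (not φ) k l M ¬s s = ¬s (path-transfer φ k l (Matching-sym k M) s)
  path-transfer (φ and ψ) k l M (s , s′) =
    path-transfer φ k (ℕ.m⊔n≤o⇒m≤o _ _ l) M s , path-transfer ψ k (ℕ.m⊔n≤o⇒n≤o (rank φ) _ l) M s′
  path-transfer (φ or ψ) k l M (inj₁ s) = inj₁ (path-transfer φ k (ℕ.m⊔n≤o⇒m≤o _ _ l) M s)
  path-transfer (φ or ψ) k l M (inj₂ s) = inj₂ (path-transfer ψ k (ℕ.m⊔n≤o⇒n≤o (rank φ) _ l) M s)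
  path-transfer (ex φ) (suc k) (s≤s l) M (x , s) with extend k M x
  ... | x′ , M′ = x′ , path-transfer φ k l M′ s
  path-transfer (all φ) (suc k) (s≤s l) M s x′ with extend k (Matching-sym (suc k) M) x′
  ... | x , M′ = path-transfer φ k l (Matching-sym k M′) (s x)

  long-paths-equivalent : ∀ (φ : Logic.Sentence FO) {N N′} → 2 ^ rank φ ≤ N → 2 ^ rank φ ≤ N′ →
    Sat (path (suc N)) [] [] φ → Sat (path (suc N′)) [] [] φ
  long-paths-equivalent φ {N} {N′} l l′ = path-transfer φ (rank φ) ℕ.≤-refl
    -- The game starts with the two ends of each path and a single long gap between them.
    (step (inj₂ (l , l′)) (sym (ℕ.+-identityʳ N)) (sym (ℕ.+-identityʳ N′)) (end refl refl) , λ ())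

  -- A monadic second-order sentence true in the paths of even length only: it
  -- asks for a proper 2-colouring whose first class contains all end vertices.

  X∋_ : ∀ {n} → Fin n → Formula (_≡ 1) n (1 ∷ [])
  X∋ i = here refl $ (i ∷ [])

  2-colouring ends-coloured : Formula (_≡ 1) 0 (1 ∷ [])
  2-colouring = all (all (not (suc zero ~ zero) or
    (((X∋ suc zero) and not (X∋ zero)) or (not (X∋ suc zero) and (X∋ zero)))))
  ends-coloured = all (ex (ex (((suc (suc zero) ~ suc zero) and (suc (suc zero) ~ zero)) and not (suc zero ≐ zero)))
    or (X∋ zero))

  even-path : Logic.Sentence MSO
  even-path = ex₂ 1 refl (2-colouring and ends-coloured)

  even : ℕ → Bool
  even zero    = true
  even (suc n) = notᵇ (even n)

  even-double : ∀ n → even (n + n) ≡ true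
  even-double zero    = refl
  even-double (suc n) = trans (cong notᵇ (cong even (ℕ.+-suc n n))) (trans (not-involutive (even (n + n))) (even-double n))

  module _ {N : ℕ} where

    EvenPositions : RelOn (Fin (suc N)) 1
    EvenPositions (i ∷ []) = even (toℕ i) ≡ true

    even⇒sat : even N ≡ true → Sat (path (suc N)) [] [] even-path
    even⇒sat evenN = EvenPositions , tt , colouring , ends
      where
      flip : ∀ {a b} → b ≡ suc a → even b ≡ notᵇ (even a)
      flip refl = refl

      different : ∀ {a b} → b ≡ notᵇ a →
        (Lift _ (a ≡ true) × ¬ Lift _ (b ≡ true)) ⊎ ((¬ Lift _ (a ≡ true)) × Lift _ (b ≡ true))
      different {true}  refl = inj₁ (lift refl , λ ())
      different {false} refl = inj₂ ((λ ()) , lift refl)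

      colouring : Sat (path (suc N)) [] (EvenPositions ∷ []) 2-colouring
      colouring x y with toℕ y ℕ.≟ suc (toℕ x) | toℕ x ℕ.≟ suc (toℕ y)
      ... | yes e | _     = inj₂ (different (flip e))
      ... | no _  | yes e = inj₂ (different (trans (sym (not-involutive (even (toℕ y)))) (cong notᵇ (sym (flip e)))))
      ... | no ¬e | no ¬f = inj₁ λ { (lift (inj₁ e)) → ¬e e ; (lift (inj₂ f)) → ¬f f }

      ends : Sat (path (suc N)) [] (EvenPositions ∷ []) ends-coloured
      ends zero = inj₂ (lift refl)
      ends x@(suc y) with suc (toℕ x) ≤? N
      ... | yes l = inj₁ (inject₁ y , fromℕ< (s≤s l) ,
        (lift (inj₂ (cong suc (sym (Fin.toℕ-inject₁ y)))) , lift (inj₁ (Fin.toℕ-fromℕ< (s≤s l)))) ,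
        λ (lift eq) → ℕ.<⇒≢ (ℕ.m<n⇒m<1+n (ℕ.n<1+n (toℕ y)))
          (trans (sym (Fin.toℕ-inject₁ y)) (trans (cong toℕ eq) (Fin.toℕ-fromℕ< (s≤s l)))))
      ... | no ¬l = inj₂ (lift (trans (cong even (ℕ.≤-antisym (Fin.toℕ≤pred[n] x) (ℕ.≤-pred (ℕ.≰⇒> ¬l)))) evenN))

    module _ (s : Sat (path (suc N)) [] [] even-path) where

      private
        R : Fin (suc N) → Set
        R i = proj₁ s (i ∷ [])

        alternate : ∀ i j → toℕ j ≡ suc (toℕ i) → (R i × ¬ R j) ⊎ (¬ R i × R j)
        alternate i j e with proj₁ (proj₂ (proj₂ s)) i j
        ... | inj₁ ¬e                     = contradiction (lift (inj₁ e)) ¬e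
        ... | inj₂ (inj₁ (lift p , ¬q)) = inj₁ (p , λ q → ¬q (lift q))
        ... | inj₂ (inj₂ (¬p , lift q)) = inj₂ ((λ p → ¬p (lift p)) , q)

        end-coloured : ∀ i → (∀ a b → E (path (suc N)) i a → E (path (suc N)) i b → a ≡ b) → R i
        end-coloured i single with proj₂ (proj₂ (proj₂ s)) i
        ... | inj₁ (a , b , (lift ia , lift ib) , a≢b) = contradiction (lift (single a b ia ib)) a≢b
        ... | inj₂ (lift r)                             = r

        first : R zero
        first = end-coloured zero λ { a b (inj₁ ia) (inj₁ ib) → Fin.toℕ-injective (trans ia (sym ib)) }

        last : ∀ i → toℕ i ≡ N → R i
        last i i≡N = end-coloured i single
          where
          beyond : ∀ a → ¬ toℕ a ≡ suc (toℕ i)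
          beyond a e = ℕ.<⇒≢ (Fin.toℕ<n a) (trans e (cong suc i≡N))

          single : ∀ a b → E (path (suc N)) i a → E (path (suc N)) i b → a ≡ b
          single a b (inj₁ ia) _         = contradiction ia (beyond a)
          single a b _         (inj₁ ib) = contradiction ib (beyond b)
          single a b (inj₂ ia) (inj₂ ib) = Fin.toℕ-injective (ℕ.suc-injective (trans (sym ia) ib))

        -- The first vertex is an end, so its colour is forced, and alternation forces all others.
        parity : ∀ m i → toℕ i ≡ m → (R i × even m ≡ true) ⊎ (¬ R i × even m ≡ false)
        parity zero    zero    _ = inj₁ (first , refl)
        parity (suc m) (suc j) e with parity m (inject₁ j) (trans (Fin.toℕ-inject₁ j) (ℕ.suc-injective e))
                                    | alternate (inject₁ j) (suc j) (cong suc (sym (Fin.toℕ-inject₁ j)))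
        ... | inj₁ (_ , ev)  | inj₁ (_ , ¬r) = inj₂ (¬r , cong notᵇ ev)
        ... | inj₁ (r , _)   | inj₂ (¬r , _) = contradiction r ¬r
        ... | inj₂ (¬r , _)  | inj₁ (r , _)  = contradiction r ¬r
        ... | inj₂ (_ , odd) | inj₂ (_ , r)  = inj₁ (r , cong notᵇ odd)

      sat⇒even : even N ≡ true
      sat⇒even with parity N (fromℕ N) (Fin.toℕ-fromℕ N)
      ... | inj₁ (_ , ev) = ev
      ... | inj₂ (¬r , _) = contradiction (last (fromℕ N) (Fin.toℕ-fromℕ N)) ¬r

open Paths using (path; path-⊑; list⇒path; rank; long-paths-equivalent; even-path; even; even-double; even⇒sat; sat⇒even)

-- Inclusions of logics

module _ {A A′ : Pred ℕ 0ℓ} (f : ∀ {r} → A r → A′ r) where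

  liftFormula : ∀ {n Δ} → Formula A n Δ → Formula A′ n Δ
  liftFormula (i ≐ j)      = i ≐ j
  liftFormula (i ~ j)      = i ~ j
  liftFormula (X $ is)     = X $ is
  liftFormula (not φ)      = not (liftFormula φ)
  liftFormula (φ and ψ)    = liftFormula φ and liftFormula ψ
  liftFormula (φ or ψ)     = liftFormula φ or liftFormula ψ
  liftFormula (ex φ)       = ex (liftFormula φ)
  liftFormula (all φ)      = all (liftFormula φ)
  liftFormula (ex₂ r a φ)  = ex₂ r (f a) (liftFormula φ)
  liftFormula (all₂ r a φ) = all₂ r (f a) (liftFormula φ)

  module _ {Range Range′ : (G : Graph) → ∀ {r} → RelOn (V G) r → Set}
           (same : ∀ {r} → A r → ∀ G (R : RelOn (V G) r) → Range G R ⇔ Range′ G R) where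

    open Semantics

    liftFormula-sat : ∀ {n Δ} (φ : Formula A n Δ) G ρ σ → Sat Range G ρ σ φ ⇔ Sat Range′ G ρ σ (liftFormula φ)
    liftFormula-sat (i ≐ j)  G ρ σ = mk⇔ id id
    liftFormula-sat (i ~ j)  G ρ σ = mk⇔ id id
    liftFormula-sat (X $ is) G ρ σ = mk⇔ id id
    liftFormula-sat (not φ)  G ρ σ = mk⇔ (_∘ from (liftFormula-sat φ G ρ σ)) (_∘ to (liftFormula-sat φ G ρ σ))
    liftFormula-sat (φ and ψ) G ρ σ = mk⇔
      (λ (p , q) → to (liftFormula-sat φ G ρ σ) p , to (liftFormula-sat ψ G ρ σ) q)
      (λ (p , q) → from (liftFormula-sat φ G ρ σ) p , from (liftFormula-sat ψ G ρ σ) q)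
    liftFormula-sat (φ or ψ) G ρ σ = mk⇔
      (Sum.map (to (liftFormula-sat φ G ρ σ)) (to (liftFormula-sat ψ G ρ σ)))
      (Sum.map (from (liftFormula-sat φ G ρ σ)) (from (liftFormula-sat ψ G ρ σ)))
    liftFormula-sat (ex φ) G ρ σ = mk⇔
      (λ (x , p) → x , to (liftFormula-sat φ G (x ∷ ρ) σ) p)
      (λ (x , p) → x , from (liftFormula-sat φ G (x ∷ ρ) σ) p)
    liftFormula-sat (all φ) G ρ σ = mk⇔
      (λ p x → to (liftFormula-sat φ G (x ∷ ρ) σ) (p x))
      (λ p x → from (liftFormula-sat φ G (x ∷ ρ) σ) (p x))
    liftFormula-sat (ex₂ r a φ) G ρ σ = mk⇔
      (λ (R , g , p) → R , to (same a G R) g , to (liftFormula-sat φ G ρ (R ∷ σ)) p)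
      (λ (R , g , p) → R , from (same a G R) g , from (liftFormula-sat φ G ρ (R ∷ σ)) p)
    liftFormula-sat (all₂ r a φ) G ρ σ = mk⇔
      (λ p R g → to (liftFormula-sat φ G ρ (R ∷ σ)) (p R (from (same a G R) g)))
      (λ p R g → from (liftFormula-sat φ G ρ (R ∷ σ)) (p R (to (same a G R) g)))

    logic-≦ : ∀ {c} (C : Pred Graph c) → logic A Range ≦⟨ C ⟩ logic A′ Range′
    logic-≦ C φ = liftFormula φ , λ G _ → liftFormula-sat φ G [] []

unary-guarded : ∀ {r} → r ≡ 1 → ∀ G (R : RelOn (V G) r) → Guarded G R
unary-guarded refl G R (u≢v , _ ∷ [] , _ , here refl , here refl) = contradiction refl u≢v

unary-range : ∀ {r} → r ≡ 1 → ∀ G (R : RelOn (V G) r) → Arbitrary G R ⇔ Guarded G R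
unary-range r≡1 G R = mk⇔ (λ _ {u} {v} → unary-guarded r≡1 G R {u} {v}) (λ _ → tt)

≦-trans : ∀ {c} {C : Pred Graph c} {L₁ L₂ L₃} → L₁ ≦⟨ C ⟩ L₂ → L₂ ≦⟨ C ⟩ L₃ → L₁ ≦⟨ C ⟩ L₃
≦-trans H K φ = let (ψ , e) = H φ ; (χ , e′) = K ψ in
  χ , λ G c → mk⇔ (to (e′ G c) ∘ to (e G c)) (from (e G c) ∘ from (e′ G c))

-- Both directions between bounded tree depth and collapse to FO.

module _ (em₁ : ExcludedMiddle (lsuc 0ℓ)) (ext : Extensionality 0ℓ 0ℓ) {c : Level} (C : Pred Graph c) where

  private
    em : ∀ {P : Set} → Dec P
    em {P} = map′ lower lift (em₁ {Lift (lsuc 0ℓ) P})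

  open Families em
  open Forests em
  open Elimination em ext
  open Games em ext
  open TypeDescriptions em ext
  open TypeFormulas em ext
  open TreeDepth em ext
  open Board

  MSO≦FO⇒bounded : SubgraphClosed C → MSO ≦⟨ C ⟩ FO → BoundedTreeDepth C
  MSO≦FO⇒bounded closed H = suc N , λ G c →
    no-path⇒td (suc N) G λ v → v , ε , λ (xs , (l , u) , eq) →
      no-long-path (closed (subst (λ n → path n ⊑ G) (cong suc eq) (list⇒path G (v ∷ xs) l u)) c)
    where
    ψ = proj₁ (H even-path)
    -- Doubling makes `N` even at once. The paths with `N` and `suc N` edges are then long enough to
    -- look alike to `ψ`, but differ in parity.
    N = 2 ^ rank ψ + 2 ^ rank ψ

    no-long-path : ¬ C (path (suc (suc N)))
    no-long-path c = odd (sat⇒even (from (proj₂ (H even-path) (path (suc (suc N))) c)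
      (long-paths-equivalent ψ 2^≤N (ℕ.m≤n⇒m≤1+n 2^≤N)
        (to (proj₂ (H even-path) (path (suc N)) (closed (path-⊑ (suc N)) c)) (even⇒sat N-even)))))
      where
      2^≤N = ℕ.m≤m+n (2 ^ rank ψ) (2 ^ rank ψ)
      N-even = even-double (2 ^ rank ψ)

      odd : even (suc N) ≢ true
      odd e = contradiction (trans (sym e) (cong notᵇ N-even)) λ ()

  bounded⇒GSO≦FO : BoundedTreeDepth C → GSO ≦⟨ C ⟩ FO
  bounded⇒GSO≦FO (d , bound) φ = ψ , λ G c → mk⇔ (φ⇒ψ G (bound G c)) (ψ⇒φ G (bound G c))
    where
    B = walkBound d
    t = threshold B d φ (adjacencyᶠ B d)

    type : Board B d → ∣ Typeᶠ d t d ∣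
    type S = typeOf (adjacencyᶠ B d) t (forest S) (initial B d S)

    Realised : ∣ Typeᶠ d t d ∣ → Set₁
    Realised τ = Σ[ S ∈ Board B d ] type S ≡ τ × Logic._⊨_ GSO (graph S) φ

    -- `Realised` quantifies over all boards and so lives in `Set₁`, where excluded middle is
    -- assumed. The formula `ψ` is not computed from `φ`.
    types = filter (λ τ → em₁ {Realised τ}) (elems (Typeᶠ d t d))

    ψ : Logic.Sentence FO
    ψ = disjunction types (hasType B d t d [])

    ψ-sat = λ G → disjunction-sat B G (λ τ → hasType-sat B G d t d [] τ {[]} refl) types

    φ⇒ψ : ∀ G → td G ≤ d → Logic._⊨_ GSO G φ → Logic._⊨_ FO G ψ
    φ⇒ψ G b s with td⇒Elim b
    ... | F , e = from (ψ-sat G) (lose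
        (∈-filter⁺ (λ τ → em₁ {Realised τ}) (complete (Typeᶠ d t d) (type S)) (S , refl , s))
        (complete-type d t G B (td⇒Short b) d [] (type S) (F , e , refl)))
      where
      S : Board B d
      S = record { graph = G ; forest = F ; elim = e ; short = td⇒Short b }

    ψ⇒φ : ∀ G → td G ≤ d → Logic._⊨_ FO G ψ → Logic._⊨_ GSO G φ
    -- The forest obtained for `G` need not be the one given by the bound on its tree depth; its
    -- type equals that of a board satisfying `φ`, from which `φ` is transferred.
    ψ⇒φ G b s with find (to (ψ-sat G) s)
    ... | τ , τ∈ , h with proj₂ (∈-filter⁻ (λ τ → em₁ {Realised τ}) {xs = elems (Typeᶠ d t d)} τ∈)
                        | sound-type d t G B (td⇒Short b) d [] τ h
    ...   | S , eq , p | F , e , eq′ = sentence-transfer B d φ S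
      (record { graph = G ; forest = F ; elim = e ; short = td⇒Short b }) (trans eq (sym eq′)) p

theorem2 : ExcludedMiddle (lsuc 0ℓ) → Extensionality 0ℓ 0ℓ →
    ∀ {c : Level} (C : Pred Graph c) → SubgraphClosed C →
    (SameExpressivePower C FO MSO ⇔ SameExpressivePower C FO GSO)
    × (SameExpressivePower C FO GSO ⇔ BoundedTreeDepth C)
theorem2 em ext C closed =
  mk⇔ (bounded⇒2 ∘ 1⇒bounded) 2⇒1 , mk⇔ (1⇒bounded ∘ 2⇒1) bounded⇒2
  where
  FO≦MSO : FO ≦⟨ C ⟩ MSO
  FO≦MSO = logic-≦ (λ ()) {Arbitrary} {Arbitrary} (λ ()) C

  FO≦GSO : FO ≦⟨ C ⟩ GSO
  FO≦GSO = logic-≦ (λ ()) {Arbitrary} {Guarded} (λ ()) C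

  MSO≦GSO : MSO ≦⟨ C ⟩ GSO
  MSO≦GSO = logic-≦ (λ _ → tt) {Arbitrary} {Guarded} unary-range C

  1⇒bounded : SameExpressivePower C FO MSO → BoundedTreeDepth C
  1⇒bounded (_ , MSO≦FO) = MSO≦FO⇒bounded em ext C closed MSO≦FO

  bounded⇒2 : BoundedTreeDepth C → SameExpressivePower C FO GSO
  bounded⇒2 b = FO≦GSO , bounded⇒GSO≦FO em ext C b

  2⇒1 : SameExpressivePower C FO GSO → SameExpressivePower C FO MSO
  2⇒1 (_ , GSO≦FO) = FO≦MSO , ≦-trans {L₁ = MSO} {GSO} {FO} MSO≦GSO GSO≦FO
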